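{- Let $p,q\in\mathbb{R}[x]$. If $\mathscr{W}(p)$ and $\mathscr{W}(q)$ have nonnegative symmetric decompositions, then so does $\mathscr{W}(pq)$. Furthermore, if the symmetric decompositions of $\mathscr{W}(p)$ and $\mathscr{W}(q)$ are $\gamma$-positive, then so is the symmetric decomposition of $\mathscr{W}(pq)$.
   Context: For a polynomial $p\in\mathbb{R}[x]$ of degree $d$, $\mathscr{W}(p)$ denotes the polynomial of degree at most $d$ defined by $\sum_{j\ge0}p(j)x^j=\mathscr{W}(p)(x)/(1-x)^{d+1}$. For a polynomial $a$ of degree at most $s$ let $\mathcal{I}_s(a)(x)=x^sa(1/x)$. Every polynomial $h$ of degree at most $d$ can be written uniquely as $h(x)=a(x)+x\,b(x)$ with $\mathcal{I}_d(a)=a$ and $\mathcal{I}_{d-1}(b)=b$; the pair $(a,b)$ is the symmetric decomposition of $h$ (with respect to $d$). The symmetric decomposition of $\mathscr{W}(p)$ is taken with respect to $d=\deg p$. It is nonnegative if $a$ and $b$ have only nonnegative coefficients, and $\gamma$-positive if $a=\sum_i\gamma_ix^i(1+x)^{d-2i}$ and $b=\sum_k\delta_kx^k(1+x)^{d-1-2k}$ with all $\gamma_i,\delta_k\ge0$. -}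

module Defs where

open import Level using (Level; _⊔_) renaming (suc to lsuc)
open import Data.Nat using (ℕ; zero; suc; _∸_; ⌊_/2⌋) renaming (_+_ to _+ℕ_; _<_ to _<ℕ_; _≤_ to _≤ℕ_)
open import Data.Bool using (if_then_else_)
open import Data.Nat using (_≤ᵇ_)
open import Data.Product using (Σ; _×_; ∃)
open import Relation.Nullary using (¬_)
open import Algebra.Bundles using (CommutativeRing)
open import Relation.Binary.Structures using (IsTotalOrder)

-- Ordered fields (abstract stand-in for ℝ)

record OrderedField (c ℓ₁ ℓ₂ : Level) : Set (lsuc (c ⊔ ℓ₁ ⊔ ℓ₂)) where
  field
    commutativeRing : CommutativeRing c ℓ₁
  open CommutativeRing commutativeRing public
  field
    _≤_          : Carrier → Carrier → Set ℓ₂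
    isTotalOrder : IsTotalOrder _≈_ _≤_
    +-mono-≤     : ∀ {x y} z → x ≤ y → (x + z) ≤ (y + z)
    *-nonneg     : ∀ {x y} → 0# ≤ x → 0# ≤ y → 0# ≤ (x * y)
    1≉0          : ¬ (1# ≈ 0#)
    inverse      : ∀ x → ¬ (x ≈ 0#) → ∃ λ y → (x * y) ≈ 1#

choose : ℕ → ℕ → ℕ
choose n       zero    = 1
choose zero    (suc k) = 0
choose (suc n) (suc k) = choose n k +ℕ choose n (suc k)

module _ {c ℓ₁ ℓ₂} (F : OrderedField c ℓ₁ ℓ₂) where
  open OrderedField F

  -- polynomials / power series as coefficient sequences (coefficient of x^k)
  Poly : Set c
  Poly = ℕ → Carrier

  fromℕ : ℕ → Carrier
  fromℕ zero    = 0#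
  fromℕ (suc n) = 1# + fromℕ n

  pow : Carrier → ℕ → Carrier
  pow x zero    = 1#
  pow x (suc n) = x * pow x n

  signed : ℕ → Carrier → Carrier
  signed zero    x = x
  signed (suc i) x = - signed i x

  sumTo : ℕ → (ℕ → Carrier) → Carrier
  sumTo zero    f = 0#
  sumTo (suc n) f = sumTo n f + f n

  HasDegree : ℕ → Poly → Set (ℓ₁)
  HasDegree d p = (¬ (p d ≈ 0#)) × (∀ k → d <ℕ k → p k ≈ 0#)

  evalAt : ℕ → Poly → ℕ → Carrier
  evalAt d p j = sumTo (suc d) (λ i → p i * pow (fromℕ j) i)

  mul : Poly → Poly → Poly
  mul p q n = sumTo (suc n) (λ i → p i * q (n ∸ i))

  -- 𝒲(p) for p of degree d: the power series (1-x)^{d+1} Σ_j p(j) x^j,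
  -- i.e. coefficient k is Σ_{i≤k} (-1)^i C(d+1,i) p(k-i).
  W : ℕ → Poly → Poly
  W d p k = sumTo (suc k) (λ i → signed i (fromℕ (choose (suc d) i)) * evalAt d p (k ∸ i))

  Palin : ℕ → Poly → Set ℓ₁
  Palin s a = (∀ k → s <ℕ k → a k ≈ 0#) × (∀ k → k ≤ℕ s → a k ≈ a (s ∸ k))

  Palin-pred : ℕ → Poly → Set ℓ₁
  Palin-pred zero    b = ∀ k → b k ≈ 0#
  Palin-pred (suc s) b = Palin s b

  shift : Poly → Poly
  shift b zero    = 0#
  shift b (suc k) = b k

  SymDecomp : ℕ → Poly → Poly → Poly → Set ℓ₁
  SymDecomp d h a b = (∀ k → h k ≈ (a k + shift b k)) × Palin d a × Palin-pred d b

  Nonneg : Poly → Set ℓ₂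
  Nonneg a = ∀ k → 0# ≤ a k

  NonnegSymDecomp : ℕ → Poly → Set (c ⊔ ℓ₁ ⊔ ℓ₂)
  NonnegSymDecomp d h = Σ Poly λ a → Σ Poly λ b → SymDecomp d h a b × Nonneg a × Nonneg b

  -- coefficient of x^k in Σ_{i < m} γ_i x^i (1+x)^{n-2i}
  gammaExp : ℕ → ℕ → (ℕ → Carrier) → Poly
  gammaExp m n γ k = sumTo m (λ i → γ i * fromℕ (gcoef i))
    where
    gcoef : ℕ → ℕ
    gcoef i = if i ≤ᵇ k then choose (n ∸ (i +ℕ i)) (k ∸ i) else 0

  GammaPos : ℕ → Poly → Set (c ⊔ ℓ₁ ⊔ ℓ₂)
  GammaPos d a = Σ (ℕ → Carrier) λ γ → (∀ i → 0# ≤ γ i) × (∀ k → a k ≈ gammaExp (suc ⌊ d /2⌋) d γ k)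

  -- b = Σ_{0 ≤ k ≤ ⌊(d-1)/2⌋} δ_k x^k (1+x)^{d-1-2k} with δ_k ≥ 0 (empty sum if d = 0)
  GammaPos-pred : ℕ → Poly → Set (c ⊔ ℓ₁ ⊔ ℓ₂)
  GammaPos-pred d b = Σ (ℕ → Carrier) λ δ → (∀ i → 0# ≤ δ i) × (∀ k → b k ≈ gammaExp ⌊ suc d /2⌋ (d ∸ 1) δ k)

  GammaPosSymDecomp : ℕ → Poly → Set (c ⊔ ℓ₁ ⊔ ℓ₂)
  GammaPosSymDecomp d h = Σ Poly λ a → Σ Poly λ b → SymDecomp d h a b × GammaPos d a × GammaPos-pred d b

{-# OPTIONS --safe #-}

-- Write y = 1 and read a series h as a form of degree d in x and y. On forms, D = ∂/∂x + ∂/∂y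
-- becomes L d h = (1 − x) h′ + d h, and with h⁽ʲ⁾ = Dʲ h / j! one has
--   𝒲(p q) = Σⱼ (x y)ʲ 𝒲(p)⁽ʲ⁾ 𝒲(q)⁽ʲ⁾,
-- since both sides behave in the same way when p is replaced by a + n p(n) (Horner's scheme).
-- For 𝒲(p) = a + x b and 𝒲(q) = a′ + x b′ the rule (x b)⁽ʲ⁾ = x b⁽ʲ⁾ + b⁽ʲ⁻¹⁾ together with
-- x² = x (x + y) − x y turns the sum into α + x β, where α and β are positive combinations of
-- products of x y, x + y and derivatives of a, b, a′, b′. The symmetric forms that are
-- nonnegative, respectively γ-positive, are the cones spanned by (x y)ⁱ (xᵐ + yᵐ), respectively
-- (x y)ⁱ (x + y)ᵐ, and these cones are closed under D and under products.
module Submission where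

open import Defs
open import Level using (Level; _⊔_)
open import Algebra.Bundles using (CommutativeRing)
import Algebra.Construct.Pointwise as Pointwise
open import Data.Bool using (if_then_else_)
open import Data.Empty using (⊥-elim)
open import Data.Nat as ℕ using (ℕ; zero; suc; z≤n; s≤s; ⌊_/2⌋; _≤ᵇ_; _<ᵇ_) renaming (_+_ to _+ℕ_)
import Data.Nat.Properties as ℕₚ
open import Data.Nat.Solver using (module +-*-Solver)
open import Data.Product using (Σ; _×_; _,_; proj₁; proj₂)
open import Data.Sum using (inj₁; inj₂)
open import Function.Base using (_∘_)
open import Relation.Binary.Definitions using (tri<; tri≈; tri>)
open import Relation.Binary.PropositionalEquality as ≡ using (_≡_)
open import Relation.Binary.Structures using (IsTotalOrder)
open import Relation.Nullary using (¬_)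
open import Relation.Nullary.Decidable using (yes; no)

private module N = +-*-Solver

-- Two lists of divided derivatives of one numerator meet in the proof. Horner's scheme yields a
-- list for which the product formula can be proved by induction on p, while q enters only through
-- an arbitrary series. A symmetric decomposition yields another, whose members are visibly
-- positive. In characteristic zero such a list is determined by its first member, so the two agree,
-- and the formula may be expanded with the second. The induction works because passing from p(n) to
-- n p(n) acts on numerators as h ↦ x h + x y D h. With g fixed, the sum of (x y)ʲ h⁽ʲ⁾ g⁽ʲ⁾
-- intertwines this operator for p with the one for p q, up to a boundary term that vanishes beyond
-- the degree. Setting y = 1 forgets the degree, on which D depends; hence the degree is an argument
-- of `L` and an index of the cones. Divided derivatives keep factorials out of all the rules.

record Derivation {c ℓ} (R : CommutativeRing c ℓ) : Set (c ⊔ ℓ) where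
  open CommutativeRing R
  field
    ∂      : Carrier → Carrier
    ∂-cong : ∀ {f g} → f ≈ g → ∂ f ≈ ∂ g
    ∂-+    : ∀ f g → ∂ (f + g) ≈ ∂ f + ∂ g
    ∂-*    : ∀ f g → ∂ (f * g) ≈ ∂ f * g + f * ∂ g
    x ω    : Carrier
    ∂x≈1   : ∂ x ≈ 1#
    -- Stated without subtraction, so that identities with `ω` are semiring identities, within reach
    -- of a solver with natural coefficients.
    ω+x≈1  : ω + x ≈ 1#

-- Divided derivatives of forms at y = 1

module Jets {c ℓ} {R : CommutativeRing c ℓ} (𝒟 : Derivation R) where
  open CommutativeRing R
  open Derivation 𝒟
  open import Algebra.Properties.Ring ring using (+-cancelʳ)
  open import Algebra.Solver.Ring.NaturalCoefficients.Default commutativeSemiring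
  open import Relation.Binary.Reasoning.Setoid setoid

  ι : ℕ → Carrier
  ι zero    = 0#
  ι (suc n) = 1# + ι n

  ι-+ : ∀ m n → ι (m +ℕ n) ≈ ι m + ι n
  ι-+ zero    n = sym (+-identityˡ (ι n))
  ι-+ (suc m) n = trans (+-congˡ (ι-+ m n)) (sym (+-assoc 1# (ι m) (ι n)))

  infixr 8 _^_
  _^_ : Carrier → ℕ → Carrier
  f ^ zero  = 1#
  f ^ suc n = f * f ^ n

  ^-+ : ∀ f m n → f ^ (m +ℕ n) ≈ f ^ m * f ^ n
  ^-+ f zero    n = sym (*-identityˡ _)
  ^-+ f (suc m) n = trans (*-congˡ (^-+ f m n)) (sym (*-assoc _ _ _))

  -- At y = 1 this is the form x + y.
  v : Carrier
  v = 1# + x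

  ∂0 : ∂ 0# ≈ 0#
  ∂0 = +-cancelʳ (∂ 0#) _ _ (begin
    ∂ 0# + ∂ 0#  ≈⟨ ∂-+ 0# 0# ⟨
    ∂ (0# + 0#)  ≈⟨ ∂-cong (+-identityˡ 0#) ⟩
    ∂ 0#         ≈⟨ +-identityˡ (∂ 0#) ⟨
    0# + ∂ 0#    ∎)

  ∂1 : ∂ 1# ≈ 0#
  ∂1 = +-cancelʳ (∂ 1#) _ _ (begin
    ∂ 1# + ∂ 1#            ≈⟨ solve 1 (λ a → a :+ a := a :* con 1 :+ con 1 :* a) refl (∂ 1#) ⟩
    ∂ 1# * 1# + 1# * ∂ 1#  ≈⟨ ∂-* 1# 1# ⟨
    ∂ (1# * 1#)            ≈⟨ ∂-cong (*-identityˡ 1#) ⟩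
    ∂ 1#                   ≈⟨ +-identityˡ (∂ 1#) ⟨
    0# + ∂ 1#              ∎)

  ∂ι : ∀ n → ∂ (ι n) ≈ 0#
  ∂ι zero    = ∂0
  ∂ι (suc n) = trans (∂-+ _ _) (trans (+-cong ∂1 (∂ι n)) (+-identityˡ 0#))

  ∂ω+1≈0 : ∂ ω + 1# ≈ 0#
  ∂ω+1≈0 = begin
    ∂ ω + 1#   ≈⟨ +-congˡ ∂x≈1 ⟨
    ∂ ω + ∂ x  ≈⟨ ∂-+ ω x ⟨
    ∂ (ω + x)  ≈⟨ ∂-cong ω+x≈1 ⟩
    ∂ 1#       ≈⟨ ∂1 ⟩
    0#         ∎

  ∂v≈1 : ∂ v ≈ 1#
  ∂v≈1 = trans (∂-+ _ _) (trans (+-cong ∂1 ∂x≈1) (+-identityˡ 1#))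

  -- With y = 1 and ω = y − x, this is ∂/∂x + ∂/∂y on forms of degree z in x and y.
  L : Carrier → Carrier → Carrier
  L z f = ω * ∂ f + z * f

  L-cong : ∀ {z w f g} → z ≈ w → f ≈ g → L z f ≈ L w g
  L-cong z≈w f≈g = +-cong (*-congˡ (∂-cong f≈g)) (*-cong z≈w f≈g)

  L-congʳ : ∀ {z f g} → f ≈ g → L z f ≈ L z g
  L-congʳ = L-cong refl

  L-+ : ∀ z f g → L z (f + g) ≈ L z f + L z g
  L-+ z f g = trans (+-congʳ (*-congˡ (∂-+ f g)))
    (solve 6 (λ w a b z f g → w :* (a :+ b) :+ z :* (f :+ g) := (w :* a :+ z :* f) :+ (w :* b :+ z :* g))
      refl ω (∂ f) (∂ g) z f g)

  L-0 : ∀ z → L z 0# ≈ 0#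
  L-0 z = trans (+-cong (trans (*-congˡ ∂0) (zeroʳ ω)) (zeroʳ z)) (+-identityˡ 0#)

  L-≈0 : ∀ z {f} → f ≈ 0# → L z f ≈ 0#
  L-≈0 z f≈0 = trans (L-congʳ f≈0) (L-0 z)

  L-suc : ∀ z f → L (1# + z) f ≈ L z f + f
  L-suc z f = solve 4 (λ w a z f → w :* a :+ (con 1 :+ z) :* f := (w :* a :+ z :* f) :+ f) refl ω (∂ f) z f

  L-* : ∀ z w f g → L (z + w) (f * g) ≈ L z f * g + f * L w g
  L-* z w f g = trans (+-congʳ (*-congˡ (∂-* f g)))
    (solve 7 (λ o a b z w f g → o :* (a :* g :+ f :* b) :+ (z :+ w) :* (f :* g)
                := (o :* a :+ z :* f) :* g :+ f :* (o :* b :+ w :* g))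
      refl ω (∂ f) (∂ g) z w f g)

  L-const : ∀ z κ f → ∂ κ ≈ 0# → L z (κ * f) ≈ κ * L z f
  L-const z κ f ∂κ≈0 = begin
    L z (κ * f)                    ≈⟨ L-cong (+-identityˡ z) refl ⟨
    L (0# + z) (κ * f)             ≈⟨ L-* 0# z κ f ⟩
    (ω * ∂ κ + 0# * κ) * f + κ * L z f
      ≈⟨ +-congʳ (*-congʳ (trans (+-cong (trans (*-congˡ ∂κ≈0) (zeroʳ ω)) (zeroˡ κ)) (+-identityˡ 0#))) ⟩
    0# * f + κ * L z f             ≈⟨ +-congʳ (zeroˡ f) ⟩
    0# + κ * L z f                 ≈⟨ +-identityˡ _ ⟩
    κ * L z f                      ∎

  -- The degree does not grow here, so the factor stands for x / y, with D (x / y) = (y - x) / y².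
  L-x₀ : ∀ z f → L z (x * f) ≈ x * L z f + ω * f
  L-x₀ z f = begin
    ω * ∂ (x * f) + z * (x * f)              ≈⟨ +-congʳ (*-congˡ (trans (∂-* x f) (+-congʳ (*-congʳ ∂x≈1)))) ⟩
    ω * (1# * f + x * ∂ f) + z * (x * f)
      ≈⟨ solve 5 (λ o x z f d → o :* (con 1 :* f :+ x :* d) :+ z :* (x :* f) := x :* (o :* d :+ z :* f) :+ o :* f)
           refl ω x z f (∂ f) ⟩
    x * L z f + ω * f                        ∎

  L-x : ∀ z f → L (1# + z) (x * f) ≈ x * L z f + f
  L-x z f = begin
    L (1# + z) (x * f)                       ≈⟨ L-suc z _ ⟩
    L z (x * f) + x * f                      ≈⟨ +-congʳ (L-x₀ z f) ⟩
    x * L z f + ω * f + x * f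
      ≈⟨ solve 4 (λ o x f l → x :* l :+ o :* f :+ x :* f := x :* l :+ (o :+ x) :* f) refl ω x f (L z f) ⟩
    x * L z f + (ω + x) * f                  ≈⟨ +-congˡ (trans (*-congʳ ω+x≈1) (*-identityˡ f)) ⟩
    x * L z f + f                            ∎

  L-v : ∀ z f → L (1# + z) (v * f) ≈ v * L z f + (f + f)
  L-v z f = begin
    L (1# + z) (v * f)               ≈⟨ L-* 1# z v f ⟩
    (ω * ∂ v + 1# * v) * f + v * L z f ≈⟨ +-congʳ (*-congʳ (+-cong (*-congˡ ∂v≈1) refl)) ⟩
    (ω * 1# + 1# * v) * f + v * L z f
      ≈⟨ solve 4 (λ o x f l → (o :* con 1 :+ con 1 :* (con 1 :+ x)) :* f :+ (con 1 :+ x) :* l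
            := (con 1 :+ x) :* l :+ (f :+ (o :+ x) :* f)) refl ω x f (L z f) ⟩
    v * L z f + (f + (ω + x) * f)    ≈⟨ +-congˡ (+-congˡ (trans (*-congʳ ω+x≈1) (*-identityˡ f))) ⟩
    v * L z f + (f + f)              ∎

  -- x stands for the form x y of degree 2.
  L-x² : ∀ z f → L (1# + (1# + z)) (x * f) ≈ x * L z f + v * f
  L-x² z f = begin
    L (1# + (1# + z)) (x * f)     ≈⟨ L-suc _ _ ⟩
    L (1# + z) (x * f) + x * f    ≈⟨ +-congʳ (L-x z f) ⟩
    x * L z f + f + x * f
      ≈⟨ solve 3 (λ x f l → x :* l :+ f :+ x :* f := x :* l :+ (con 1 :+ x) :* f) refl x f (L z f) ⟩
    x * L z f + v * f             ∎

  -- This is D ((x y)ʲ f) = j (x y)ʲ⁻¹ (x + y) f + (x y)ʲ D f, multiplied by x y so that no exponent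
  -- j - 1 occurs.
  L-x^ : ∀ j z f → x * L (ι (j +ℕ j) + z) (x ^ j * f) ≈ x ^ j * (ι j * (v * f) + x * L z f)
  L-x^ zero z f = begin
    x * L (0# + z) (1# * f)  ≈⟨ *-congˡ (L-cong (+-identityˡ z) (*-identityˡ f)) ⟩
    x * L z f                ≈⟨ solve 3 (λ x l vf → x :* l := con 1 :* (con 0 :* vf :+ x :* l)) refl x (L z f) (v * f) ⟩
    1# * (0# * (v * f) + x * L z f) ∎
  L-x^ (suc j) z f = begin
    x * L (1# + ι (j +ℕ suc j) + z) (x * x ^ j * f)
      ≈⟨ *-congˡ (L-cong idx (*-assoc _ _ _)) ⟩
    x * L (1# + (1# + (ι (j +ℕ j) + z))) (x * (x ^ j * f))
      ≈⟨ *-congˡ (L-x² _ _) ⟩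
    x * (x * L (ι (j +ℕ j) + z) (x ^ j * f) + v * (x ^ j * f))
      ≈⟨ *-congˡ (+-congʳ (L-x^ j z f)) ⟩
    x * (x ^ j * (ι j * (v * f) + x * L z f) + v * (x ^ j * f))
      ≈⟨ solve 6 (λ x xj j v f l → x :* (xj :* (j :* (v :* f) :+ x :* l) :+ v :* (xj :* f))
            := x :* xj :* ((con 1 :+ j) :* (v :* f) :+ x :* l)) refl x (x ^ j) (ι j) v f (L z f) ⟩
    x * x ^ j * ((1# + ι j) * (v * f) + x * L z f) ∎
    where
    idx : 1# + ι (j +ℕ suc j) + z ≈ 1# + (1# + (ι (j +ℕ j) + z))
    idx = trans (+-congʳ (+-congˡ (reflexive (≡.cong ι (ℕₚ.+-suc j j)))))
      (solve 2 (λ a z → con 1 :+ (con 1 :+ a) :+ z := con 1 :+ (con 1 :+ (a :+ z))) refl (ι (j +ℕ j)) z)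

  -- It rests on D (y - x) = 0, and lets D pass the factor (1 - x)ᵈ⁺¹ of a numerator.
  L-ω^ : ∀ n → L (ι n) (ω ^ n) ≈ 0#
  L-ω^ zero    = trans (+-cong (trans (*-congˡ ∂1) (zeroʳ ω)) (zeroˡ 1#)) (+-identityˡ 0#)
  L-ω^ (suc n) = begin
    L (1# + ι n) (ω * ω ^ n)                      ≈⟨ L-* 1# (ι n) ω (ω ^ n) ⟩
    (ω * ∂ ω + 1# * ω) * ω ^ n + ω * L (ι n) (ω ^ n)
      ≈⟨ solve 4 (λ o d p l → (o :* d :+ con 1 :* o) :* p :+ o :* l := o :* (d :+ con 1) :* p :+ o :* l)
           refl ω (∂ ω) (ω ^ n) (L (ι n) (ω ^ n)) ⟩
    ω * (∂ ω + 1#) * ω ^ n + ω * L (ι n) (ω ^ n)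
      ≈⟨ +-cong (*-congʳ (*-congˡ ∂ω+1≈0)) (*-congˡ (L-ω^ n)) ⟩
    ω * 0# * ω ^ n + ω * 0#
      ≈⟨ solve 2 (λ o p → o :* con 0 :* p :+ o :* con 0 := con 0) refl ω (ω ^ n) ⟩
    0# ∎

  prev : (ℕ → Carrier) → ℕ → Carrier
  prev H zero    = 0#
  prev H (suc j) = H j

  -- H lists the divided powers Dʲ/j! of D = L applied to the form H 0 of degree z − s.
  Jet : Carrier → ℕ → (ℕ → Carrier) → Set ℓ
  Jet z s H = ∀ j → L z (H j) ≈ ι (suc j) * H (suc j) + ι (s +ℕ j) * H j

  Jet-+ : ∀ {z s H G} → Jet z s H → Jet z s G → Jet z s (λ j → H j + G j)
  Jet-+ {z} {s} {H} {G} JH JG j = begin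
    L z (H j + G j)        ≈⟨ L-+ z _ _ ⟩
    L z (H j) + L z (G j)  ≈⟨ +-cong (JH j) (JG j) ⟩
    (ι (suc j) * H (suc j) + ι (s +ℕ j) * H j) + (ι (suc j) * G (suc j) + ι (s +ℕ j) * G j)
      ≈⟨ solve 6 (λ a b c d e f → (a :* b :+ c :* d) :+ (a :* e :+ c :* f) := a :* (b :+ e) :+ c :* (d :+ f))
           refl (ι (suc j)) (H (suc j)) (ι (s +ℕ j)) (H j) (G (suc j)) (G j) ⟩
    ι (suc j) * (H (suc j) + G (suc j)) + ι (s +ℕ j) * (H j + G j) ∎

  xJet : (ℕ → Carrier) → ℕ → Carrier
  xJet B j = x * B j + prev B j

  prev-Jet₁ : ∀ {z B} → Jet z 1 B → ∀ j → L z (prev B j) ≈ ι j * B j + ι j * prev B j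
  prev-Jet₁ {z} {B} JB zero    = trans (L-0 z) (sym (solve 1 (λ b → con 0 :* b :+ con 0 :* con 0 := con 0) refl (B 0)))
  prev-Jet₁ JB (suc j) = JB j

  -- Multiplication by x raises the degree from z - 1 to z, which turns the offset 1 into 0.
  Jet-x : ∀ {z B} → Jet z 1 B → Jet z 0 (xJet B)
  Jet-x {z} {B} JB j = begin
    L z (x * B j + prev B j)                      ≈⟨ L-+ _ _ _ ⟩
    L z (x * B j) + L z (prev B j)                ≈⟨ +-cong (L-x₀ z (B j)) (prev-Jet₁ JB j) ⟩
    (x * L z (B j) + ω * B j) + (ι j * B j + ι j * prev B j)
      ≈⟨ +-congʳ (+-congʳ (*-congˡ (JB j))) ⟩
    (x * (ι (suc j) * B (suc j) + ι (suc j) * B j) + ω * B j) + (ι j * B j + ι j * prev B j)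
      ≈⟨ solve 6 (λ x o j b b₊ b₋ →
           (x :* ((con 1 :+ j) :* b₊ :+ (con 1 :+ j) :* b) :+ o :* b) :+ (j :* b :+ j :* b₋)
           := ((con 1 :+ j) :* (x :* b₊) :+ j :* b :+ j :* (x :* b :+ b₋)) :+ (o :+ x) :* b)
           refl x ω (ι j) (B j) (B (suc j)) (prev B j) ⟩
    (ι (suc j) * (x * B (suc j)) + ι j * B j + ι j * (x * B j + prev B j)) + (ω + x) * B j
      ≈⟨ +-congˡ (*-congʳ ω+x≈1) ⟩
    (ι (suc j) * (x * B (suc j)) + ι j * B j + ι j * (x * B j + prev B j)) + 1# * B j
      ≈⟨ solve 5 (λ x j b b₊ b₋ →
           ((con 1 :+ j) :* (x :* b₊) :+ j :* b :+ j :* (x :* b :+ b₋)) :+ con 1 :* b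
           := (con 1 :+ j) :* (x :* b₊ :+ b) :+ j :* (x :* b :+ b₋))
           refl x (ι j) (B j) (B (suc j)) (prev B j) ⟩
    ι (suc j) * (x * B (suc j) + B j) + ι j * (x * B j + prev B j) ∎

  -- The divided derivatives of x h + x L h, the W-polynomial of n p(n) if h is that of p.
  tJet : (ℕ → Carrier) → ℕ → Carrier
  tJet H j = x * H j + ι j * prev H j + ι j * (v * H j) + ι (suc j) * (x * H (suc j))

  prev-Jet₀ : ∀ {z H} → Jet z 0 H → ∀ j → L (1# + z) (prev H j) ≈ ι j * H j + ι j * prev H j
  prev-Jet₀ {z} {H} JH zero    = trans (L-0 _) (sym (solve 1 (λ b → con 0 :* b :+ con 0 :* con 0 := con 0) refl (H 0)))
  prev-Jet₀ {z} {H} JH (suc j) = begin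
    L (1# + z) (H j)                                 ≈⟨ L-suc z _ ⟩
    L z (H j) + H j                                  ≈⟨ +-congʳ (JH j) ⟩
    ι (suc j) * H (suc j) + ι j * H j + H j
      ≈⟨ solve 3 (λ j h h₊ → (con 1 :+ j) :* h₊ :+ j :* h :+ h := (con 1 :+ j) :* h₊ :+ (con 1 :+ j) :* h)
           refl (ι j) (H j) (H (suc j)) ⟩
    ι (suc j) * H (suc j) + ι (suc j) * H j          ∎

  -- The formula of `tJet` is Leibniz's rule with x⁽¹⁾ = 1, (x y)⁽¹⁾ = x + y and (x y)⁽²⁾ = 1, where
  -- D h has the divided derivatives (j + 1) h⁽ʲ⁺¹⁾. The coefficient j of `prev H j` collects 1 from
  -- x h and j - 1 from x y D h.
  Jet-t : ∀ {z H} → Jet z 0 H → Jet (1# + z) 0 (tJet H)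
  Jet-t {z} {H} JH j = begin
    L (1# + z) (x * H j + ι j * prev H j + ι j * (v * H j) + ι (suc j) * (x * H (suc j)))
      ≈⟨ trans (L-+ _ _ _) (+-congʳ (trans (L-+ _ _ _) (+-congʳ (L-+ _ _ _)))) ⟩
    L (1# + z) (x * H j) + L (1# + z) (ι j * prev H j) + L (1# + z) (ι j * (v * H j))
      + L (1# + z) (ι (suc j) * (x * H (suc j)))
      ≈⟨ +-cong (+-cong (+-cong
           (trans (L-x z _) (+-congʳ (*-congˡ (JH j))))
           (trans (L-const _ _ _ (∂ι j)) (*-congˡ (prev-Jet₀ JH j))))
           (trans (L-const _ _ _ (∂ι j)) (*-congˡ (trans (L-v z _) (+-congʳ (*-congˡ (JH j)))))))
           (trans (L-const _ _ _ (∂ι (suc j))) (*-congˡ (trans (L-x z _) (+-congʳ (*-congˡ (JH (suc j))))))) ⟩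
    (x * (ι (suc j) * H (suc j) + ι j * H j) + H j)
      + ι j * (ι j * H j + ι j * prev H j)
      + ι j * (v * (ι (suc j) * H (suc j) + ι j * H j) + (H j + H j))
      + ι (suc j) * (x * (ι (suc (suc j)) * H (suc (suc j)) + ι (suc j) * H (suc j)) + H (suc j))
      ≈⟨ solve 6 (λ x j h₋ h h₊ h₊₊ →
           (x :* ((con 1 :+ j) :* h₊ :+ j :* h) :+ h)
           :+ j :* (j :* h :+ j :* h₋)
           :+ j :* ((con 1 :+ x) :* ((con 1 :+ j) :* h₊ :+ j :* h) :+ (h :+ h))
           :+ (con 1 :+ j) :* (x :* ((con 1 :+ (con 1 :+ j)) :* h₊₊ :+ (con 1 :+ j) :* h₊) :+ h₊)
           := (con 1 :+ j) :* (x :* h₊ :+ (con 1 :+ j) :* h :+ (con 1 :+ j) :* ((con 1 :+ x) :* h₊)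
                 :+ (con 1 :+ (con 1 :+ j)) :* (x :* h₊₊))
           :+ j :* (x :* h :+ j :* h₋ :+ j :* ((con 1 :+ x) :* h) :+ (con 1 :+ j) :* (x :* h₊)))
           refl x (ι j) (prev H j) (H j) (H (suc j)) (H (suc (suc j))) ⟩
    ι (suc j) * tJet H (suc j) + ι j * tJet H j ∎

  -- The sum of (x y)ʲ h⁽ʲ⁾ g⁽ʲ⁾ over j

  sum : ℕ → (ℕ → Carrier) → Carrier
  sum zero    f = 0#
  sum (suc n) f = sum n f + f n

  sum-cong : ∀ n {f g} → (∀ j → f j ≈ g j) → sum n f ≈ sum n g
  sum-cong zero    f≈g = refl
  sum-cong (suc n) f≈g = +-cong (sum-cong n f≈g) (f≈g n)

  star : ℕ → (ℕ → Carrier) → (ℕ → Carrier) → Carrier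
  star N H G = sum N (λ j → x ^ j * (H j * G j))

  star-cong : ∀ N {H H′ G G′} → (∀ j → H j ≈ H′ j) → (∀ j → G j ≈ G′ j) → star N H G ≈ star N H′ G′
  star-cong N H≈ G≈ = sum-cong N (λ j → *-congˡ (*-cong (H≈ j) (G≈ j)))

  star-+ : ∀ N H H′ G → star N (λ j → H j + H′ j) G ≈ star N H G + star N H′ G
  star-+ zero    H H′ G = sym (+-identityˡ 0#)
  star-+ (suc N) H H′ G = trans (+-congʳ (star-+ N H H′ G))
    (solve 6 (λ s s′ p h h′ g → s :+ s′ :+ p :* ((h :+ h′) :* g) := (s :+ p :* (h :* g)) :+ (s′ :+ p :* (h′ :* g)))
      refl (star N H G) (star N H′ G) (x ^ N) (H N) (H′ N) (G N))

  -- The jet of a form that D annihilates; the constants of Horner's scheme lead to such forms.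
  single : Carrier → ℕ → Carrier
  single f zero    = f
  single f (suc j) = 0#

  Jet-single : ∀ {z f} → L z f ≈ 0# → Jet z 0 (single f)
  Jet-single {z} {f} Lf≈0 zero    = trans Lf≈0 (sym (solve 1 (λ f → (con 1 :+ con 0) :* con 0 :+ con 0 :* f := con 0) refl f))
  Jet-single {z} {f} Lf≈0 (suc j) = trans (L-0 z)
    (sym (solve 2 (λ a b → a :* con 0 :+ b :* con 0 := con 0) refl (ι (suc (suc j))) (ι (suc j))))

  star-single : ∀ N f G → star (suc N) (single f) G ≈ f * G 0
  star-single zero    f G = solve 2 (λ f g → con 0 :+ con 1 :* (f :* g) := f :* g) refl f (G 0)
  star-single (suc N) f G = trans (+-cong (star-single N f G) (trans (*-congˡ (zeroˡ _)) (zeroʳ _))) (+-identityʳ _)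

  -- The boundary term of the shifted sum is kept on the left to avoid subtraction.
  star-t : ∀ {z w H G} → Jet z 0 H → Jet w 0 G → ∀ N →
           star N (tJet H) G + x ^ N * (ι N * (prev H N * G N))
           ≈ x * star N H G + x * L (z + w) (star N H G)
  star-t {z} {w} {H} {G} JH JG zero = begin
    0# + 1# * (0# * (0# * G 0))
      ≈⟨ solve 2 (λ g x → con 0 :+ con 1 :* (con 0 :* (con 0 :* g)) := x :* con 0 :+ x :* con 0) refl (G 0) x ⟩
    x * 0# + x * 0#                    ≈⟨ +-congˡ (*-congˡ (L-0 _)) ⟨
    x * 0# + x * L (z + w) 0#          ∎
  star-t {z} {w} {H} {G} JH JG (suc N) = begin
    star N (tJet H) G + x ^ N * (tJet H N * G N) + x * x ^ N * (ι (suc N) * (H N * G (suc N)))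
      -- A summation by parts: D also acts on the second factor, and the contribution (N + 1) h⁽ᴺ⁾
      -- g⁽ᴺ⁺¹⁾ comes from the term `prev H` of `tJet` at N + 1, which is the new boundary term.
      ≈⟨ solve 9 (λ x s p n h₋ h h₊ g g₊ →
           s :+ p :* ((x :* h :+ n :* h₋ :+ n :* ((con 1 :+ x) :* h) :+ (con 1 :+ n) :* (x :* h₊)) :* g)
             :+ x :* p :* ((con 1 :+ n) :* (h :* g₊))
           := (s :+ p :* (n :* (h₋ :* g)))
             :+ (x :* (p :* (h :* g))
                 :+ p :* (n :* ((con 1 :+ x) :* (h :* g)) :+ x :* ((con 1 :+ n) :* (h₊ :* g :+ h :* g₊)))))
           refl x (star N (tJet H) G) (x ^ N) (ι N) (prev H N) (H N) (H (suc N)) (G N) (G (suc N)) ⟩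
    (star N (tJet H) G + x ^ N * (ι N * (prev H N * G N)))
      + (x * (x ^ N * (H N * G N))
         + x ^ N * (ι N * (v * (H N * G N)) + x * (ι (suc N) * (H (suc N) * G N + H N * G (suc N)))))
      ≈⟨ +-cong (star-t JH JG N) (+-congˡ (sym term)) ⟩
    (x * S + x * L (z + w) S) + (x * (x ^ N * (H N * G N)) + x * L (z + w) (x ^ N * (H N * G N)))
      ≈⟨ solve 5 (λ x s ls t lt → (x :* s :+ x :* ls) :+ (x :* t :+ x :* lt) := x :* (s :+ t) :+ x :* (ls :+ lt))
           refl x S (L (z + w) S) (x ^ N * (H N * G N)) (L (z + w) (x ^ N * (H N * G N))) ⟩
    x * (S + x ^ N * (H N * G N)) + x * (L (z + w) S + L (z + w) (x ^ N * (H N * G N)))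
      ≈⟨ +-congˡ (*-congˡ (L-+ _ _ _)) ⟨
    x * (S + x ^ N * (H N * G N)) + x * L (z + w) (S + x ^ N * (H N * G N)) ∎
    where
    S = star N H G
    n₂ = ι (N +ℕ N)
    -- N derivatives have lowered either degree by N, so this product has degree z + w - 2 N; the
    -- factor (x y)ᴺ restores z + w.
    HG : L (z + w - n₂) (H N * G N) ≈ ι (suc N) * (H (suc N) * G N + H N * G (suc N))
    HG = +-cancelʳ (n₂ * (H N * G N)) _ _ (begin
      L (z + w - n₂) (H N * G N) + n₂ * (H N * G N)
        ≈⟨ solve 5 (λ o d a n f → o :* d :+ a :* f :+ n :* f := o :* d :+ (a :+ n) :* f)
             refl ω (∂ (H N * G N)) (z + w - n₂) n₂ (H N * G N) ⟩
      L (z + w - n₂ + n₂) (H N * G N)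
        ≈⟨ L-cong (trans (+-assoc _ _ _) (trans (+-congˡ (-‿inverseˡ n₂)) (+-identityʳ _))) refl ⟩
      L (z + w) (H N * G N)                 ≈⟨ L-* z w _ _ ⟩
      L z (H N) * G N + H N * L w (G N)     ≈⟨ +-cong (*-congʳ (JH N)) (*-congˡ (JG N)) ⟩
      (ι (suc N) * H (suc N) + ι N * H N) * G N + H N * (ι (suc N) * G (suc N) + ι N * G N)
        ≈⟨ solve 5 (λ n h h₊ g g₊ →
             ((con 1 :+ n) :* h₊ :+ n :* h) :* g :+ h :* ((con 1 :+ n) :* g₊ :+ n :* g)
             := (con 1 :+ n) :* (h₊ :* g :+ h :* g₊) :+ (n :+ n) :* (h :* g))
             refl (ι N) (H N) (H (suc N)) (G N) (G (suc N)) ⟩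
      ι (suc N) * (H (suc N) * G N + H N * G (suc N)) + (ι N + ι N) * (H N * G N)
        ≈⟨ +-congˡ (*-congʳ (ι-+ N N)) ⟨
      ι (suc N) * (H (suc N) * G N + H N * G (suc N)) + n₂ * (H N * G N) ∎)
    term : x * L (z + w) (x ^ N * (H N * G N))
           ≈ x ^ N * (ι N * (v * (H N * G N)) + x * (ι (suc N) * (H (suc N) * G N + H N * G (suc N))))
    term = begin
      x * L (z + w) (x ^ N * (H N * G N))
        ≈⟨ *-congˡ (L-cong (trans (sym (+-identityʳ _)) (trans (+-congˡ (sym (-‿inverseˡ n₂)))
             (solve 3 (λ a m n → a :+ (m :+ n) := n :+ (a :+ m)) refl (z + w) (- n₂) n₂))) refl) ⟩
      x * L (n₂ + (z + w - n₂)) (x ^ N * (H N * G N)) ≈⟨ L-x^ N _ _ ⟩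
      x ^ N * (ι N * (v * (H N * G N)) + x * L (z + w - n₂) (H N * G N)) ≈⟨ *-congˡ (+-congˡ (*-congˡ HG)) ⟩
      x ^ N * (ι N * (v * (H N * G N)) + x * (ι (suc N) * (H (suc N) * G N + H N * G (suc N)))) ∎

  -- Numerators over powers of 1 - x, and Hadamard products

  𝒲 : ℕ → Carrier → Carrier
  𝒲 d P = ω ^ suc d * P

  -- D annihilates the power of `ω`, so only the series is differentiated. The summand `x * 𝒲 d P`
  -- appears because the power `ω ^ suc d` calls for `L` in degree d + 1, one above the degree of
  -- the numerator.
  𝒲-x∂ : ∀ d P → 𝒲 (suc d) (x * ∂ P) ≈ x * 𝒲 d P + x * L (ι d) (𝒲 d P)
  𝒲-x∂ d P = begin
    ω * ω ^ suc d * (x * ∂ P)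
      ≈⟨ solve 5 (λ o p x f f′ → o :* p :* (x :* f′) := x :* (con 0 :* f :+ p :* (o :* f′ :+ con 0 :* f)))
           refl ω (ω ^ suc d) x P (∂ P) ⟩
    x * (0# * P + ω ^ suc d * L 0# P)                        ≈⟨ *-congˡ (+-congʳ (*-congʳ (L-ω^ (suc d)))) ⟨
    x * (L (ι (suc d)) (ω ^ suc d) * P + ω ^ suc d * L 0# P) ≈⟨ *-congˡ (L-* _ _ _ _) ⟨
    x * L (ι (suc d) + 0#) (𝒲 d P)                           ≈⟨ *-congˡ (L-cong (+-identityʳ _) refl) ⟩
    x * L (ι (suc d)) (𝒲 d P)                                ≈⟨ *-congˡ (L-suc _ _) ⟩
    x * (L (ι d) (𝒲 d P) + 𝒲 d P)                            ≈⟨ trans (distribˡ _ _ _) (+-comm _ _) ⟩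
    x * 𝒲 d P + x * L (ι d) (𝒲 d P)                          ∎

  -- P is the generating function of a polynomial of degree at most d and M is the Hadamard product with P.
  record Multiplier (d : ℕ) (P : Carrier) (M : Carrier → Carrier) : Set (c ⊔ ℓ) where
    field
      jet       : ℕ → Carrier
      isJet     : Jet (ι d) 0 jet
      jet-0     : jet 0 ≈ 𝒲 d P
      vanishing : ∀ j → d ℕ.< j → jet j ≈ 0#
      star-𝒲    : ∀ {e G Q} N → d ℕ.< N → Jet (ι e) 0 G → G 0 ≈ 𝒲 e Q → star N jet G ≈ 𝒲 (d +ℕ e) (M Q)

  module Horner {geo : Carrier} (ω*geo≈1 : ω * geo ≈ 1#) where

    constant : ∀ {κ P M} → ∂ κ ≈ 0# → P ≈ κ * geo → (∀ Q → M Q ≈ κ * Q) → Multiplier 0 P M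
    constant {κ} {P} {M} ∂κ≈0 P≈ M≈ = record
      { jet       = single κ
      ; isJet     = Jet-single (trans (+-cong (trans (*-congˡ ∂κ≈0) (zeroʳ ω)) (zeroˡ κ)) (+-identityˡ 0#))
      ; jet-0     = sym (begin
          ω * 1# * P            ≈⟨ *-congˡ P≈ ⟩
          ω * 1# * (κ * geo)    ≈⟨ solve 3 (λ o k g → o :* con 1 :* (k :* g) := k :* (o :* g)) refl ω κ geo ⟩
          κ * (ω * geo)         ≈⟨ trans (*-congˡ ω*geo≈1) (*-identityʳ κ) ⟩
          κ                     ∎)
      ; vanishing = λ { (suc j) _ → refl }
      ; star-𝒲    = λ { {e} {G} {Q} (suc N) _ _ G0≈ → begin
          star (suc N) (single κ) G  ≈⟨ star-single N κ G ⟩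
          κ * G 0                    ≈⟨ *-congˡ G0≈ ⟩
          κ * (ω ^ suc e * Q)        ≈⟨ solve 3 (λ k o q → k :* (o :* q) := o :* (k :* q)) refl κ (ω ^ suc e) Q ⟩
          ω ^ suc e * (κ * Q)        ≈⟨ *-congˡ (M≈ Q) ⟨
          𝒲 e (M Q)                  ∎ }
      }

    -- Here p(n) = κ + n p′(n). The summands are treated apart: D annihilates the numerator of κ,
    -- and `tJet` lifts the jet of p′.
    step : ∀ {d κ P M P′ M′} → ∂ κ ≈ 0# → Multiplier d P′ M′ →
           P ≈ κ * geo + x * ∂ P′ → (∀ Q → M Q ≈ κ * Q + x * ∂ (M′ Q)) → Multiplier (suc d) P M
    step {d} {κ} {P} {M} {P′} {M′} ∂κ≈0 mult P≈ M≈ = record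
      { jet       = jet
      ; isJet     = Jet-+ {s = 0} (Jet-single L≈0) (Jet-t m.isJet)
      ; jet-0     = jet-0
      ; vanishing = vanishing
      ; star-𝒲    = star-𝒲
      }
      where
      module m = Multiplier mult
      -- The numerator of κ / (1 - x) over (1 - x)ᵈ⁺².
      κω = κ * ω ^ suc d
      jet : ℕ → Carrier
      jet j = single κω j + tJet m.jet j
      L≈0 : L (ι (suc d)) κω ≈ 0#
      L≈0 = trans (L-const _ _ _ ∂κ≈0) (trans (*-congˡ (L-ω^ (suc d))) (zeroʳ κ))
      jet-0 : jet 0 ≈ 𝒲 (suc d) P
      jet-0 = begin
        κω + (x * m.jet 0 + 0# * 0# + 0# * (v * m.jet 0) + (1# + 0#) * (x * m.jet 1))
          ≈⟨ solve 5 (λ k x v h h₁ → k :+ (x :* h :+ con 0 :* con 0 :+ con 0 :* (v :* h) :+ (con 1 :+ con 0) :* (x :* h₁))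
               := k :+ (x :* h :+ x :* ((con 1 :+ con 0) :* h₁ :+ con 0 :* h))) refl κω x v (m.jet 0) (m.jet 1) ⟩
        κω + (x * m.jet 0 + x * (ι 1 * m.jet 1 + 0# * m.jet 0))  ≈⟨ +-congˡ (+-congˡ (*-congˡ (m.isJet 0))) ⟨
        κω + (x * m.jet 0 + x * L (ι d) (m.jet 0))
          ≈⟨ +-cong (sym (trans (*-congˡ ω*geo≈1) (*-identityʳ κω))) (+-cong (*-congˡ m.jet-0) (*-congˡ (L-congʳ m.jet-0))) ⟩
        κω * (ω * geo) + (x * 𝒲 d P′ + x * L (ι d) (𝒲 d P′))      ≈⟨ +-congˡ (𝒲-x∂ d P′) ⟨
        κ * ω ^ suc d * (ω * geo) + ω * ω ^ suc d * (x * ∂ P′)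
          ≈⟨ solve 5 (λ k p o g q → k :* p :* (o :* g) :+ o :* p :* q := o :* p :* (k :* g :+ q))
               refl κ (ω ^ suc d) ω geo (x * ∂ P′) ⟩
        ω * ω ^ suc d * (κ * geo + x * ∂ P′)                      ≈⟨ *-congˡ P≈ ⟨
        𝒲 (suc d) P                                               ∎
      vanishing : ∀ j → suc d ℕ.< j → jet j ≈ 0#
      vanishing (suc j) (s≤s d<j) = begin
        0# + (x * m.jet (suc j) + ι (suc j) * m.jet j + ι (suc j) * (v * m.jet (suc j)) + ι (suc (suc j)) * (x * m.jet (suc (suc j))))
          ≈⟨ +-congˡ (+-cong (+-cong (+-cong (*-congˡ v₁) (*-congˡ (m.vanishing j d<j))) (*-congˡ (*-congˡ v₁))) (*-congˡ (*-congˡ v₂))) ⟩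
        0# + (x * 0# + ι (suc j) * 0# + ι (suc j) * (v * 0#) + ι (suc (suc j)) * (x * 0#))
          ≈⟨ solve 4 (λ x a v b → con 0 :+ (x :* con 0 :+ a :* con 0 :+ a :* (v :* con 0) :+ b :* (x :* con 0)) := con 0)
               refl x (ι (suc j)) v (ι (suc (suc j))) ⟩
        0# ∎
        where
        v₁ = m.vanishing (suc j) (ℕₚ.m<n⇒m<1+n d<j)
        v₂ = m.vanishing (suc (suc j)) (ℕₚ.m<n⇒m<1+n (ℕₚ.m<n⇒m<1+n d<j))
      star-𝒲 : ∀ {e G Q} N → suc d ℕ.< N → Jet (ι e) 0 G → G 0 ≈ 𝒲 e Q → star N jet G ≈ 𝒲 (suc d +ℕ e) (M Q)
      star-𝒲 {e} {G} {Q} (suc N) (s≤s d<N) JG G0≈ = begin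
        star (suc N) jet G                                            ≈⟨ star-+ (suc N) _ _ G ⟩
        star (suc N) (single κω) G + star (suc N) (tJet m.jet) G      ≈⟨ +-cong (star-single N κω G) tail ⟩
        κω * G 0 + 𝒲 (suc d +ℕ e) (x * ∂ (M′ Q))                      ≈⟨ +-congʳ (*-congˡ G0≈) ⟩
        κω * (ω ^ suc e * Q) + 𝒲 (suc d +ℕ e) (x * ∂ (M′ Q))
          ≈⟨ solve 5 (λ k p q f r → k :* p :* (q :* f) :+ r := p :* q :* (k :* f) :+ r) refl κ (ω ^ suc d) (ω ^ suc e) Q _ ⟩
        ω ^ suc d * ω ^ suc e * (κ * Q) + 𝒲 (suc d +ℕ e) (x * ∂ (M′ Q))
          ≈⟨ +-congʳ (*-congʳ (trans (sym (^-+ ω (suc d) (suc e))) (reflexive (≡.cong (λ n → ω ^ suc n) (ℕₚ.+-suc d e))))) ⟩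
        𝒲 (suc d +ℕ e) (κ * Q) + 𝒲 (suc d +ℕ e) (x * ∂ (M′ Q))        ≈⟨ distribˡ _ _ _ ⟨
        𝒲 (suc d +ℕ e) (κ * Q + x * ∂ (M′ Q))                         ≈⟨ *-congˡ (M≈ Q) ⟨
        𝒲 (suc d +ℕ e) (M Q)                                          ∎
        where
        S≈ : star (suc N) m.jet G ≈ 𝒲 (d +ℕ e) (M′ Q)
        S≈ = m.star-𝒲 (suc N) (ℕₚ.m<n⇒m<1+n d<N) JG G0≈
        tail : star (suc N) (tJet m.jet) G ≈ 𝒲 (suc d +ℕ e) (x * ∂ (M′ Q))
        tail = begin
          star (suc N) (tJet m.jet) G
            -- The boundary term of `star-t` is inserted as zero; it vanishes since `m.jet N` does
            -- for N > d.
            ≈⟨ solve 4 (λ s p n g → s := s :+ p :* (n :* (con 0 :* g))) refl _ (x ^ suc N) (ι (suc N)) (G (suc N)) ⟩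
          star (suc N) (tJet m.jet) G + x ^ suc N * (ι (suc N) * (0# * G (suc N)))
            ≈⟨ +-congˡ (*-congˡ (*-congˡ (*-congʳ (m.vanishing N d<N)))) ⟨
          star (suc N) (tJet m.jet) G + x ^ suc N * (ι (suc N) * (m.jet N * G (suc N)))
            ≈⟨ star-t m.isJet JG (suc N) ⟩
          x * star (suc N) m.jet G + x * L (ι d + ι e) (star (suc N) m.jet G)
            ≈⟨ +-cong (*-congˡ S≈) (*-congˡ (L-cong (sym (ι-+ d e)) S≈)) ⟩
          x * 𝒲 (d +ℕ e) (M′ Q) + x * L (ι (d +ℕ e)) (𝒲 (d +ℕ e) (M′ Q))
            ≈⟨ 𝒲-x∂ (d +ℕ e) (M′ Q) ⟨
          𝒲 (suc d +ℕ e) (x * ∂ (M′ Q)) ∎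

  -- The products in (A + x B + prev B) (C + x E + prev E), sorted by degree: together with (x y)ʲ,
  -- those without x have degree d + e, and those with one x leave a form of degree d + e - 1. Of x²
  -- B E only the share x (x + y) B E is kept, and prev B prev E is absent because it cancels.
  α-term β-term : (A B C E : ℕ → Carrier) → ℕ → Carrier
  α-term A B C E j = x ^ j * (A j * C j) + (x ^ j * (A j * prev E j) + x ^ j * (prev B j * C j))
  β-term A B C E j = x ^ j * (A j * E j) + (x ^ j * (prev B j * E j)
    + (x ^ j * (B j * C j) + (x ^ j * (B j * prev E j) + v * (x ^ j * (B j * E j)))))

  -- As forms, x² = x (x + y) − x y: the negative contributions − (x y) B E telescope
  -- against the terms prev B * prev E, up to the last one, kept on the left.
  star-decomposition : ∀ A B C E N →
    star N (λ j → A j + xJet B j) (λ j → C j + xJet E j) + x ^ N * (prev B N * prev E N)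
    ≈ sum N (α-term A B C E) + x * sum N (β-term A B C E)
  star-decomposition A B C E zero =
    solve 1 (λ x → con 0 :+ con 1 :* (con 0 :* con 0) := con 0 :+ x :* con 0) refl x
  star-decomposition A B C E (suc N) = begin
    star N _ _ + x ^ N * ((A N + xJet B N) * (C N + xJet E N)) + x * x ^ N * (B N * E N)
      ≈⟨ solve 9 (λ s x p a b b₋ c e e₋ →
           s :+ p :* ((a :+ (x :* b :+ b₋)) :* (c :+ (x :* e :+ e₋))) :+ x :* p :* (b :* e)
           := (s :+ p :* (b₋ :* e₋))
             :+ ((p :* (a :* c) :+ (p :* (a :* e₋) :+ p :* (b₋ :* c)))
             :+ x :* (p :* (a :* e) :+ (p :* (b₋ :* e) :+ (p :* (b :* c) :+ (p :* (b :* e₋)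
                 :+ (con 1 :+ x) :* (p :* (b :* e))))))))
           refl _ x (x ^ N) (A N) (B N) (prev B N) (C N) (E N) (prev E N) ⟩
    (star N _ _ + x ^ N * (prev B N * prev E N)) + (α-term A B C E N + x * β-term A B C E N)
      ≈⟨ +-congʳ (star-decomposition A B C E N) ⟩
    (sum N (α-term A B C E) + x * sum N (β-term A B C E)) + (α-term A B C E N + x * β-term A B C E N)
      ≈⟨ solve 5 (λ x a b c d → (a :+ x :* b) :+ (c :+ x :* d) := (a :+ c) :+ x :* (b :+ d)) refl x _ _ _ _ ⟩
    (sum N (α-term A B C E) + α-term A B C E N) + x * (sum N (β-term A B C E) + β-term A B C E N) ∎

-- Cones of forms, closed under D and products

record NonnegConstants {c ℓ} {R : CommutativeRing c ℓ} (𝒟 : Derivation R) (s : Level) : Set (c ⊔ ℓ ⊔ Level.suc s) where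
  open CommutativeRing R
  open Derivation 𝒟
  open Jets 𝒟 using (ι)
  field
    S       : Carrier → Set s
    S-*     : ∀ {f g} → S f → S g → S (f * g)
    S-ι     : ∀ n → S (ι n)
    ∂S≈0    : ∀ {f} → S f → ∂ f ≈ 0#
    -- `inv n` is 1 / (n + 1), the factor that leads from one divided derivative to the next; its
    -- positivity keeps these in the cone.
    inv     : ℕ → Carrier
    S-inv   : ∀ n → S (inv n)
    inv-ι   : ∀ n → inv n * ι (suc n) ≈ 1#

-- In a form of degree d = 2 i + m, the power xⁱ stands for (x y)ⁱ.
module Cones {c ℓ s} {R : CommutativeRing c ℓ} {𝒟 : Derivation R} (𝒮 : NonnegConstants 𝒟 s)
             (b : ℕ → CommutativeRing.Carrier R) where
  open CommutativeRing R
  open Derivation 𝒟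
  open Jets 𝒟
  open NonnegConstants 𝒮
  open import Algebra.Properties.Ring ring using (+-cancelʳ)
  open import Algebra.Solver.Ring.NaturalCoefficients.Default commutativeSemiring
  open import Relation.Binary.Reasoning.Setoid setoid

  -- Membership is a derivation from generators, so each closure property reduces by recursion to
  -- the generators.
  data Cone (d : ℕ) (f : Carrier) : Set (c ⊔ ℓ ⊔ s) where
    nil  : f ≈ 0# → Cone d f
    mono : ∀ {κ} i m → S κ → i +ℕ i +ℕ m ≡ d → f ≈ κ * (x ^ i * b m) → Cone d f
    add  : ∀ {g h} → Cone d g → Cone d h → f ≈ g + h → Cone d f

  Cone-resp : ∀ {d f g} → f ≈ g → Cone d f → Cone d g
  Cone-resp f≈g (nil p)          = nil (trans (sym f≈g) p)
  Cone-resp f≈g (mono i m k e p) = mono i m k e (trans (sym f≈g) p)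
  Cone-resp f≈g (add u w p)      = add u w (trans (sym f≈g) p)

  Cone-scale : ∀ {d κ f} → S κ → Cone d f → Cone d (κ * f)
  Cone-scale {κ = κ} k (nil p)          = nil (trans (*-congˡ p) (zeroʳ κ))
  Cone-scale {κ = κ} k (mono i m l e p) = mono i m (S-* k l) e (trans (*-congˡ p) (sym (*-assoc _ _ _)))
  Cone-scale {κ = κ} k (add u w p)      = add (Cone-scale k u) (Cone-scale k w) (trans (*-congˡ p) (distribˡ _ _ _))

  Cone-x^ : ∀ {d r f} j → j +ℕ j +ℕ d ≡ r → Cone d f → Cone r (x ^ j * f)
  Cone-x^ j eq (nil p) = nil (trans (*-congˡ p) (zeroʳ _))
  Cone-x^ {f = f} j ≡.refl (mono {κ} i m l ≡.refl p) = mono (j +ℕ i) m l index (begin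
    x ^ j * f                          ≈⟨ *-congˡ p ⟩
    x ^ j * (κ * (x ^ i * b m))
      ≈⟨ solve 4 (λ p k q g → p :* (k :* (q :* g)) := k :* (p :* q :* g)) refl (x ^ j) κ (x ^ i) (b m) ⟩
    κ * (x ^ j * x ^ i * b m)          ≈⟨ *-congˡ (*-congʳ (^-+ x j i)) ⟨
    κ * (x ^ (j +ℕ i) * b m)           ∎)
    where
    index : (j +ℕ i) +ℕ (j +ℕ i) +ℕ m ≡ j +ℕ j +ℕ (i +ℕ i +ℕ m)
    index = N.solve 3 (λ i j m → (j N.:+ i) N.:+ (j N.:+ i) N.:+ m N.:= j N.:+ j N.:+ (i N.:+ i N.:+ m)) ≡.refl i j m
  Cone-x^ j eq (add u w p) = add (Cone-x^ j eq u) (Cone-x^ j eq w) (trans (*-congˡ p) (distribˡ _ _ _))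

  -- Indexed by degree + 1, so that forms of degree −1 vanish.
  Kp : ℕ → Carrier → Set (c ⊔ ℓ ⊔ s)
  Kp zero    f = Level.Lift (c ⊔ s) (f ≈ 0#)
  Kp (suc n) f = Cone n f

  Kp-0 : ∀ n {f} → f ≈ 0# → Kp n f
  Kp-0 zero    p = Level.lift p
  Kp-0 (suc n) p = nil p

  Kp-+ : ∀ n {f g} → Kp n f → Kp n g → Kp n (f + g)
  Kp-+ zero    (Level.lift p) (Level.lift q) = Level.lift (trans (+-cong p q) (+-identityˡ 0#))
  Kp-+ (suc n) u w = add u w refl

  Kp-resp : ∀ n {f g} → f ≈ g → Kp n f → Kp n g
  Kp-resp zero    f≈g (Level.lift p) = Level.lift (trans (sym f≈g) p)
  Kp-resp (suc n) = Cone-resp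

  Kp-scale : ∀ n {κ f} → S κ → Kp n f → Kp n (κ * f)
  Kp-scale zero    {κ} k (Level.lift p) = Level.lift (trans (*-congˡ p) (zeroʳ κ))
  Kp-scale (suc n) = Cone-scale

  Kp-sum : ∀ n N {f} → (∀ j → Kp n (f j)) → Kp n (sum N f)
  Kp-sum n zero    F = Kp-0 n refl
  Kp-sum n (suc N) F = Kp-+ n (Kp-sum n N F) (F N)

  module Closed
    (b1≈v : b 1 ≈ v)
    (b-*  : ∀ m n → Cone (m +ℕ n) (b m * b n))
    (L-b  : ∀ m → Kp m (L (ι m) (b m))) where

    Cone-* : ∀ {d e f g} → Cone d f → Cone e g → Cone (d +ℕ e) (f * g)
    Cone-* {g = g} (nil p) _ = nil (trans (*-congʳ p) (zeroˡ g))
    Cone-* {g = g} (add u w p) y = add (Cone-* u y) (Cone-* w y) (trans (*-congʳ p) (distribʳ g _ _))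
    Cone-* {f = f} _ (nil p) = nil (trans (*-congˡ p) (zeroʳ f))
    Cone-* {f = f} u (add y z p) = add (Cone-* u y) (Cone-* u z) (trans (*-congˡ p) (distribˡ f _ _))
    Cone-* {f = f} {g} (mono {κ} i m k ≡.refl p) (mono {λ′} j n l ≡.refl q) =
      Cone-resp (sym eq) (Cone-scale (S-* k l) (Cone-x^ (i +ℕ j) index (b-* m n)))
      where
      index : (i +ℕ j) +ℕ (i +ℕ j) +ℕ (m +ℕ n) ≡ (i +ℕ i +ℕ m) +ℕ (j +ℕ j +ℕ n)
      index = N.solve 4 (λ i j m n → (i N.:+ j) N.:+ (i N.:+ j) N.:+ (m N.:+ n) N.:= (i N.:+ i N.:+ m) N.:+ (j N.:+ j N.:+ n)) ≡.refl i j m n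
      eq : f * g ≈ κ * λ′ * (x ^ (i +ℕ j) * (b m * b n))
      eq = begin
        f * g                                              ≈⟨ *-cong p q ⟩
        κ * (x ^ i * b m) * (λ′ * (x ^ j * b n))
          ≈⟨ solve 6 (λ k l p q f g → k :* (p :* f) :* (l :* (q :* g)) := k :* l :* (p :* q :* (f :* g)))
               refl κ λ′ (x ^ i) (x ^ j) (b m) (b n) ⟩
        κ * λ′ * (x ^ i * x ^ j * (b m * b n))             ≈⟨ *-congˡ (*-congʳ (^-+ x i j)) ⟨
        κ * λ′ * (x ^ (i +ℕ j) * (b m * b n))              ∎

    Kp-v : ∀ r {f} → Kp (r ℕ.∸ 1) f → Kp r (v * f)
    Kp-v zero          (Level.lift p) = Level.lift (trans (*-congˡ p) (zeroʳ v))
    Kp-v (suc zero)    (Level.lift p) = nil (trans (*-congˡ p) (zeroʳ v))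
    Kp-v (suc (suc r)) u = Cone-* (mono 0 1 (S-ι 1) ≡.refl
      (trans (sym b1≈v) (solve 1 (λ b → b := (con 1 :+ con 0) :* (con 1 :* b)) refl (b 1)))) u

    -- The degrees have to match only when both indices are positive: an index 0, which truncated
    -- subtraction yields once j is large, makes a factor zero, and zero lies in every cone.
    Kp-* : ∀ {p q r f g} j → (∀ n m → p ≡ suc n → q ≡ suc m → suc (j +ℕ j +ℕ (n +ℕ m)) ≡ r) →
           Kp p f → Kp q g → Kp r (x ^ j * (f * g))
    Kp-* {zero}  {q}     {r} j _ (Level.lift u) w = Kp-0 r (trans (*-congˡ (trans (*-congʳ u) (zeroˡ _))) (zeroʳ _))
    Kp-* {suc p} {zero}  {r} j _ u (Level.lift w) = Kp-0 r (trans (*-congˡ (trans (*-congˡ w) (zeroʳ _))) (zeroʳ _))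
    Kp-* {suc p} {suc q} {r} j eq u w with eq p q ≡.refl ≡.refl
    ... | ≡.refl = Cone-x^ j ≡.refl (Cone-* u w)

    Kp-x : ∀ n {f} → Kp n f → Kp (suc (suc n)) (x * f)
    Kp-x zero    (Level.lift p) = nil (trans (*-congˡ p) (zeroʳ x))
    Kp-x (suc n) u              = Cone-resp (*-congʳ (*-identityʳ x)) (Cone-x^ 1 ≡.refl u)

    L-x^b : ∀ i m → Kp (i +ℕ i +ℕ m) (L (ι (i +ℕ i +ℕ m)) (x ^ i * b m))
    L-x^b zero    m = Kp-resp m (L-congʳ (sym (*-identityˡ (b m)))) (L-b m)
    L-x^b (suc i) m rewrite ℕₚ.+-suc i i = Kp-resp (suc (suc n))
      (trans (sym (L-x² (ι n) (x ^ i * b m))) (L-congʳ (sym (*-assoc _ _ _))))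
      (Kp-+ (suc (suc n)) (Kp-x n (L-x^b i m)) (Kp-v (suc (suc n)) x^ib))
      where
      n = i +ℕ i +ℕ m
      x^ib : Cone n (x ^ i * b m)
      x^ib = mono i m (S-ι 1) ≡.refl (solve 1 (λ f → f := (con 1 :+ con 0) :* f) refl _)

    Kp-L : ∀ n {f} → Kp (suc n) f → Kp n (L (ι n) f)
    Kp-L n (nil p) = Kp-0 n (L-≈0 _ p)
    Kp-L _ (mono i m k ≡.refl p) = Kp-resp (i +ℕ i +ℕ m)
      (sym (trans (L-congʳ p) (L-const _ _ _ (∂S≈0 k)))) (Kp-scale (i +ℕ i +ℕ m) k (L-x^b i m))
    Kp-L n (add u w p) = Kp-resp n (sym (trans (L-congʳ p) (L-+ _ _ _))) (Kp-+ n (Kp-L n u) (Kp-L n w))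

    -- The argument of `L` is the degree left after j derivatives of a form of degree d - s. Where
    -- the subtraction truncates, the form is already zero by `Kp-jetOf`.
    jetOf : ℕ → ℕ → Carrier → ℕ → Carrier
    jetOf d s f zero    = f
    jetOf d s f (suc j) = inv j * L (ι (d ℕ.∸ (s +ℕ j))) (jetOf d s f j)

    Kp-jetOf : ∀ d s {f} → Kp (suc d ℕ.∸ s) f → ∀ j → Kp (suc d ℕ.∸ (s +ℕ j)) (jetOf d s f j)
    Kp-jetOf d s u zero rewrite ℕₚ.+-identityʳ s = u
    Kp-jetOf d s {f} u (suc j) rewrite ℕₚ.+-suc s j = Kp-scale (d ℕ.∸ k) (S-inv j) L-jet
      where
      k = s +ℕ j
      jet∈ : Kp (suc d ℕ.∸ k) (jetOf d s f j)
      jet∈ = Kp-jetOf d s u j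
      L-jet : Kp (d ℕ.∸ k) (L (ι (d ℕ.∸ k)) (jetOf d s f j))
      L-jet with k ℕ.≤? d
      ... | yes k≤d = Kp-L (d ℕ.∸ k) (≡.subst (λ n → Kp n (jetOf d s f j)) (ℕₚ.+-∸-assoc 1 k≤d) jet∈)
      ... | no  k≰d = Kp-0 (d ℕ.∸ k) (L-≈0 _ (Level.lower
        (≡.subst (λ n → Kp n (jetOf d s f j)) (ℕₚ.m≤n⇒m∸n≡0 (ℕₚ.≰⇒> k≰d)) jet∈)))

    Jet-jetOf : ∀ d s {f} → Kp (suc d ℕ.∸ s) f → Jet (ι d) s (jetOf d s f)
    Jet-jetOf d s {f} u j with s +ℕ j ℕ.≤? d
    ... | yes k≤d = begin
      L (ι d) H                                        ≈⟨ L-cong (reflexive (≡.cong ι (≡.sym (ℕₚ.m∸n+n≡m k≤d)))) refl ⟩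
      L (ι (d ℕ.∸ k +ℕ k)) H                           ≈⟨ L-cong (ι-+ (d ℕ.∸ k) k) refl ⟩
      L (ι (d ℕ.∸ k) + ι k) H
        ≈⟨ solve 5 (λ o f′ a c f → o :* f′ :+ (a :+ c) :* f := con 1 :* (o :* f′ :+ a :* f) :+ c :* f)
             refl ω (∂ H) (ι (d ℕ.∸ k)) (ι k) H ⟩
      1# * L (ι (d ℕ.∸ k)) H + ι k * H                 ≈⟨ +-congʳ (*-congʳ (inv-ι j)) ⟨
      inv j * ι (suc j) * L (ι (d ℕ.∸ k)) H + ι k * H
        ≈⟨ solve 4 (λ a c l r → a :* c :* l :+ r := c :* (a :* l) :+ r) refl (inv j) (ι (suc j)) _ _ ⟩
      ι (suc j) * (inv j * L (ι (d ℕ.∸ k)) H) + ι k * H ∎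
      where
      k = s +ℕ j
      H = jetOf d s f j
    ... | no  k≰d = begin
      L (ι d) H                                        ≈⟨ L-≈0 _ H≈0 ⟩
      0#
        ≈⟨ solve 3 (λ a c e → con 0 := a :* (c :* con 0) :+ e :* con 0) refl (ι (suc j)) (inv j) (ι k) ⟩
      ι (suc j) * (inv j * 0#) + ι k * 0#
        ≈⟨ +-cong (*-congˡ (*-congˡ (L-≈0 _ H≈0))) (*-congˡ H≈0) ⟨
      ι (suc j) * (inv j * L (ι (d ℕ.∸ k)) H) + ι k * H ∎
      where
      k = s +ℕ j
      H = jetOf d s f j
      H≈0 : H ≈ 0#
      H≈0 = Level.lower (≡.subst (λ n → Kp n H) (ℕₚ.m≤n⇒m∸n≡0 (ℕₚ.≰⇒> k≰d)) (Kp-jetOf d s u j))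

    -- The recurrence determines (j + 1) h⁽ʲ⁺¹⁾, and j + 1 is invertible.
    Jet-unique : ∀ {z H G} → Jet z 0 H → Jet z 0 G → H 0 ≈ G 0 → ∀ j → H j ≈ G j
    Jet-unique JH JG eq zero = eq
    Jet-unique {z} {H} {G} JH JG eq (suc j) = begin
      H (suc j)                          ≈⟨ cancel (H (suc j)) ⟨
      inv j * (ι (suc j) * H (suc j))    ≈⟨ *-congˡ (+-cancelʳ (ι j * H j) _ _ same) ⟩
      inv j * (ι (suc j) * G (suc j))    ≈⟨ cancel (G (suc j)) ⟩
      G (suc j)                          ∎
      where
      cancel : ∀ f → inv j * (ι (suc j) * f) ≈ f
      cancel f = trans (sym (*-assoc _ _ _)) (trans (*-congʳ (inv-ι j)) (*-identityˡ f))
      same : ι (suc j) * H (suc j) + ι j * H j ≈ ι (suc j) * G (suc j) + ι j * H j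
      same = begin
        ι (suc j) * H (suc j) + ι j * H j  ≈⟨ JH j ⟨
        L z (H j)                          ≈⟨ L-congʳ (Jet-unique JH JG eq j) ⟩
        L z (G j)                          ≈⟨ JG j ⟩
        ι (suc j) * G (suc j) + ι j * G j  ≈⟨ +-congˡ (*-congˡ (Jet-unique JH JG eq j)) ⟨
        ι (suc j) * G (suc j) + ι j * H j  ∎

    Decomposition : ℕ → Carrier → Set (c ⊔ ℓ ⊔ s)
    Decomposition d h = Σ Carrier λ f → Σ Carrier λ g → Kp (suc d) f × Kp d g × h ≈ f + x * g

    Decomposition-resp : ∀ {d h k} → h ≈ k → Decomposition d h → Decomposition d k
    Decomposition-resp h≈k (f , g , f∈ , g∈ , h≈) = f , g , f∈ , g∈ , trans (sym h≈k) h≈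

    ∸-suc : ∀ {d j n} → d ℕ.∸ j ≡ suc n → d ≡ suc n +ℕ j
    ∸-suc {d}     {zero}  eq = ≡.trans eq (≡.sym (ℕₚ.+-identityʳ _))
    ∸-suc {suc d} {suc j} {n} eq = ≡.trans (≡.cong suc (∸-suc {d} {j} eq)) (≡.sym (ℕₚ.+-suc (suc n) j))

    Decomposition-* : ∀ {d e P M Q} → Multiplier d P M →
      Decomposition d (𝒲 d P) → Decomposition e (𝒲 e Q) → Decomposition (d +ℕ e) (𝒲 (d +ℕ e) (M Q))
    Decomposition-* {d} {e} {P} {M} {Q} mult (a , b′ , a∈ , b∈ , P≈) (c′ , e′ , c∈ , e∈ , Q≈) =
      sum N (α-term A B C E) , sum N (β-term A B C E) ,
      Kp-sum (suc (d +ℕ e)) N α∈ , Kp-sum (d +ℕ e) N β∈ , result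
      where
      module m = Multiplier mult
      -- Beyond d, as `star-𝒲` requires, and such that the boundary term of `star-decomposition`
      -- contains `B d`, a form of degree -1 and so zero.
      N = suc d
      A = jetOf d 0 a
      B = jetOf d 1 b′
      C = jetOf e 0 c′
      E = jetOf e 1 e′
      H G : ℕ → Carrier
      H j = A j + xJet B j
      G j = C j + xJet E j

      A∈ : ∀ j → Kp (suc d ℕ.∸ j) (A j)
      A∈ = Kp-jetOf d 0 a∈
      B∈ : ∀ j → Kp (d ℕ.∸ j) (B j)
      B∈ = Kp-jetOf d 1 b∈
      C∈ : ∀ j → Kp (suc e ℕ.∸ j) (C j)
      C∈ = Kp-jetOf e 0 c∈
      E∈ : ∀ j → Kp (e ℕ.∸ j) (E j)
      E∈ = Kp-jetOf e 1 e∈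
      B⁻∈ : ∀ j → Kp (suc d ℕ.∸ j) (prev B j)
      B⁻∈ zero    = nil refl
      B⁻∈ (suc j) = B∈ j
      E⁻∈ : ∀ j → Kp (suc e ℕ.∸ j) (prev E j)
      E⁻∈ zero    = nil refl
      E⁻∈ (suc j) = E∈ j


      index : ∀ {p q r} j → suc r ≡ p +ℕ q → ∀ n m → p ℕ.∸ j ≡ suc n → q ℕ.∸ j ≡ suc m →
              suc (j +ℕ j +ℕ (n +ℕ m)) ≡ r
      index {p} {q} {r} j eq n m p≡ q≡ = ℕₚ.suc-injective (≡.sym (≡.trans eq
        (≡.trans (≡.cong₂ _+ℕ_ (∸-suc {p} {j} p≡) (∸-suc {q} {j} q≡))
        (N.solve 3 (λ j n m → (N.con 1 N.:+ n N.:+ j) N.:+ (N.con 1 N.:+ m N.:+ j)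
           N.:= N.con 2 N.:+ (j N.:+ j N.:+ (n N.:+ m))) ≡.refl j n m))))

      i₁₁ : ∀ j n m → suc d ℕ.∸ j ≡ suc n → suc e ℕ.∸ j ≡ suc m → suc (j +ℕ j +ℕ (n +ℕ m)) ≡ suc (d +ℕ e)
      i₁₁ j = index {suc d} {suc e} j (≡.cong suc (≡.sym (ℕₚ.+-suc d e)))
      i₁₀ : ∀ j n m → suc d ℕ.∸ j ≡ suc n → e ℕ.∸ j ≡ suc m → suc (j +ℕ j +ℕ (n +ℕ m)) ≡ d +ℕ e
      i₁₀ j = index {suc d} {e} j ≡.refl
      i₀₁ : ∀ j n m → d ℕ.∸ j ≡ suc n → suc e ℕ.∸ j ≡ suc m → suc (j +ℕ j +ℕ (n +ℕ m)) ≡ d +ℕ e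
      i₀₁ j = index {d} {suc e} j (≡.sym (ℕₚ.+-suc d e))
      -- Both factors stem from forms of degrees d - 1 and e - 1, so the product falls one degree
      -- short of β; the factor `v` makes up for it.
      i₀₀ : ∀ j n m → d ℕ.∸ j ≡ suc n → e ℕ.∸ j ≡ suc m → suc (j +ℕ j +ℕ (n +ℕ m)) ≡ d +ℕ e ℕ.∸ 1
      i₀₀ j n m p≡ q≡ with eq ← ∸-suc {d} {j} p≡ rewrite eq = ≡.sym (≡.trans (≡.cong (n +ℕ j +ℕ_) (∸-suc {e} {j} q≡))
        (N.solve 3 (λ j n m → (n N.:+ j) N.:+ (N.con 1 N.:+ m N.:+ j)
           N.:= N.con 1 N.:+ (j N.:+ j N.:+ (n N.:+ m))) ≡.refl j n m))

      α∈ : ∀ j → Kp (suc (d +ℕ e)) (α-term A B C E j)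
      α∈ j = Kp-+ _ (Kp-* j (i₁₁ j) (A∈ j) (C∈ j))
             (Kp-+ _ (Kp-* j (i₁₁ j) (A∈ j) (E⁻∈ j)) (Kp-* j (i₁₁ j) (B⁻∈ j) (C∈ j)))
      β∈ : ∀ j → Kp (d +ℕ e) (β-term A B C E j)
      β∈ j = Kp-+ r (Kp-* j (i₁₀ j) (A∈ j) (E∈ j)) (Kp-+ r (Kp-* j (i₁₀ j) (B⁻∈ j) (E∈ j))
             (Kp-+ r (Kp-* j (i₀₁ j) (B∈ j) (C∈ j)) (Kp-+ r (Kp-* j (i₀₁ j) (B∈ j) (E⁻∈ j))
             (Kp-v r (Kp-* j (i₀₀ j) (B∈ j) (E∈ j))))))
        where r = d +ℕ e

      JH : Jet (ι d) 0 H
      JH = Jet-+ {s = 0} (Jet-jetOf d 0 a∈) (Jet-x (Jet-jetOf d 1 b∈))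
      JG : Jet (ι e) 0 G
      JG = Jet-+ {s = 0} (Jet-jetOf e 0 c∈) (Jet-x (Jet-jetOf e 1 e∈))
      H≈ : ∀ j → m.jet j ≈ H j
      H≈ = Jet-unique m.isJet JH (trans m.jet-0 (trans P≈ (+-congˡ (sym (+-identityʳ _)))))
      B-last : B d ≈ 0#
      B-last = Level.lower (≡.subst (λ n → Kp n (B d)) (ℕₚ.n∸n≡0 d) (B∈ d))

      result : 𝒲 (d +ℕ e) (M Q) ≈ sum N (α-term A B C E) + x * sum N (β-term A B C E)
      result = begin
        𝒲 (d +ℕ e) (M Q)                              ≈⟨ m.star-𝒲 N ℕₚ.≤-refl JG (trans (+-congˡ (+-identityʳ _)) (sym Q≈)) ⟨
        star N m.jet G                                ≈⟨ star-cong N H≈ (λ _ → refl) ⟩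
        star N H G                                    ≈⟨ solve 3 (λ s p e → s := s :+ p :* (con 0 :* e)) refl _ (x ^ N) (E d) ⟩
        star N H G + x ^ N * (0# * E d)               ≈⟨ +-congˡ (*-congˡ (*-congʳ B-last)) ⟨
        star N H G + x ^ N * (B d * E d)              ≈⟨ star-decomposition A B C E N ⟩
        sum N (α-term A B C E) + x * sum N (β-term A B C E) ∎

-- The generators xᵐ + yᵐ and (x + y)ᵐ

module BinomialCone {c ℓ s} {R : CommutativeRing c ℓ} {𝒟 : Derivation R} (𝒮 : NonnegConstants 𝒟 s) where
  open CommutativeRing R
  open Derivation 𝒟
  open Jets 𝒟
  open NonnegConstants 𝒮
  open import Algebra.Solver.Ring.NaturalCoefficients.Default commutativeSemiring
  open import Relation.Binary.Reasoning.Setoid setoid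

  b : ℕ → Carrier
  b m = 1# + x ^ m

  open Cones 𝒮 b public

  -- (xᵐ + yᵐ) (xⁿ + yⁿ) = (xᵐ⁺ⁿ + yᵐ⁺ⁿ) + (x y)ᵐ (xⁿ⁻ᵐ + yⁿ⁻ᵐ).
  b-*-≤ : ∀ {m n} → m ℕ.≤ n → Cone (m +ℕ n) (b m * b n)
  b-*-≤ {m} {n} m≤n = add
    (mono 0 (m +ℕ n) (S-ι 1) ≡.refl refl)
    (mono m (n ℕ.∸ m) (S-ι 1) (≡.trans (ℕₚ.+-assoc m m _) (≡.cong (m +ℕ_) (ℕₚ.m+[n∸m]≡n m≤n))) refl)
    (begin
    (1# + x ^ m) * (1# + x ^ n)
      ≈⟨ solve 2 (λ p q → (con 1 :+ p) :* (con 1 :+ q) := (con 1 :+ con 0) :* (con 1 :* (con 1 :+ p :* q)) :+ (con 1 :+ con 0) :* (p :+ q))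
           refl (x ^ m) (x ^ n) ⟩
    ι 1 * (1# * (1# + x ^ m * x ^ n)) + ι 1 * (x ^ m + x ^ n)
      ≈⟨ +-cong (*-congˡ (*-congˡ (+-congˡ (sym (^-+ x m n))))) (*-congˡ (+-congˡ
           (trans (reflexive (≡.cong (x ^_) (≡.sym (ℕₚ.m+[n∸m]≡n m≤n)))) (^-+ x m (n ℕ.∸ m))))) ⟩
    ι 1 * (1# * b (m +ℕ n)) + ι 1 * (x ^ m + x ^ m * x ^ (n ℕ.∸ m))
      ≈⟨ +-congˡ (*-congˡ (solve 2 (λ p q → p :+ p :* q := p :* (con 1 :+ q)) refl (x ^ m) (x ^ (n ℕ.∸ m)))) ⟩
    ι 1 * (1# * b (m +ℕ n)) + ι 1 * (x ^ m * b (n ℕ.∸ m)) ∎)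

  b-* : ∀ m n → Cone (m +ℕ n) (b m * b n)
  b-* m n with ℕₚ.≤-total m n
  ... | inj₁ m≤n = b-*-≤ m≤n
  ... | inj₂ n≤m = ≡.subst (λ d → Cone d (b m * b n)) (ℕₚ.+-comm n m) (Cone-resp (*-comm (b n) (b m)) (b-*-≤ n≤m))

  -- In degree z, the constant 1 stands for the power of y with exponent z.
  L-1 : ∀ z → L z 1# ≈ z
  L-1 z = trans (+-cong (trans (*-congˡ ∂1) (zeroʳ ω)) (*-identityʳ z)) (+-identityˡ z)

  L-x^suc : ∀ m → L (ι (suc m)) (x ^ suc m) ≈ ι (suc m) * x ^ m
  L-x^suc zero = begin
    L (1# + 0#) (x * 1#)    ≈⟨ L-x 0# 1# ⟩
    x * L 0# 1# + 1#        ≈⟨ +-congʳ (*-congˡ (L-1 0#)) ⟩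
    x * 0# + 1#             ≈⟨ solve 1 (λ x → x :* con 0 :+ con 1 := (con 1 :+ con 0) :* con 1) refl x ⟩
    (1# + 0#) * 1#          ∎
  L-x^suc (suc m) = begin
    L (1# + ι (suc m)) (x * x ^ suc m)            ≈⟨ L-x (ι (suc m)) (x ^ suc m) ⟩
    x * L (ι (suc m)) (x ^ suc m) + x ^ suc m     ≈⟨ +-congʳ (*-congˡ (L-x^suc m)) ⟩
    x * (ι (suc m) * x ^ m) + x * x ^ m
      ≈⟨ solve 3 (λ x n p → x :* (n :* p) :+ x :* p := (con 1 :+ n) :* (x :* p)) refl x (ι (suc m)) (x ^ m) ⟩
    (1# + ι (suc m)) * (x * x ^ m)                ∎

  -- D (xᵐ + yᵐ) = m (xᵐ⁻¹ + yᵐ⁻¹), a nonnegative multiple of the previous generator.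
  L-b : ∀ m → Kp m (L (ι m) (b m))
  L-b zero    = Level.lift (trans (L-+ _ _ _) (trans (+-cong (L-1 0#) (L-1 0#)) (+-identityˡ 0#)))
  L-b (suc m) = mono 0 m (S-ι (suc m)) ≡.refl (begin
    L (ι (suc m)) (1# + x ^ suc m)                      ≈⟨ L-+ _ _ _ ⟩
    L (ι (suc m)) 1# + L (ι (suc m)) (x ^ suc m)        ≈⟨ +-cong (L-1 _) (L-x^suc m) ⟩
    ι (suc m) + ι (suc m) * x ^ m
      ≈⟨ solve 2 (λ n p → n :+ n :* p := n :* (con 1 :* (con 1 :+ p))) refl (ι (suc m)) (x ^ m) ⟩
    ι (suc m) * (1# * b m)                              ∎)

  open Closed (+-congˡ (*-identityʳ x)) b-* L-b public

module GammaCone {c ℓ s} {R : CommutativeRing c ℓ} {𝒟 : Derivation R} (𝒮 : NonnegConstants 𝒟 s) where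
  open CommutativeRing R
  open Derivation 𝒟
  open Jets 𝒟
  open NonnegConstants 𝒮
  open import Algebra.Solver.Ring.NaturalCoefficients.Default commutativeSemiring
  open import Relation.Binary.Reasoning.Setoid setoid

  open Cones 𝒮 (v ^_) public

  v^-* : ∀ m n → Cone (m +ℕ n) (v ^ m * v ^ n)
  v^-* m n = mono 0 (m +ℕ n) (S-ι 1) ≡.refl
    (trans (sym (^-+ v m n)) (solve 1 (λ p → p := (con 1 :+ con 0) :* (con 1 :* p)) refl (v ^ (m +ℕ n))))

  L-v^0 : L 0# (v ^ 0) ≈ 0#
  L-v^0 = trans (+-cong (trans (*-congˡ ∂1) (zeroʳ ω)) (zeroˡ 1#)) (+-identityˡ 0#)

  -- The doubling comes from D (x + y) = 2.
  L-v^suc : ∀ m → L (ι (suc m)) (v ^ suc m) ≈ (ι (suc m) + ι (suc m)) * v ^ m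
  L-v^suc zero = begin
    L (1# + 0#) (v * 1#)          ≈⟨ L-v 0# 1# ⟩
    v * L 0# 1# + (1# + 1#)       ≈⟨ +-congʳ (*-congˡ L-v^0) ⟩
    v * 0# + (1# + 1#)
      ≈⟨ solve 1 (λ v → v :* con 0 :+ (con 1 :+ con 1) := (con 1 :+ con 0 :+ (con 1 :+ con 0)) :* con 1) refl v ⟩
    (1# + 0# + (1# + 0#)) * 1#    ∎
  L-v^suc (suc m) = begin
    L (1# + ι (suc m)) (v * v ^ suc m)                          ≈⟨ L-v (ι (suc m)) (v ^ suc m) ⟩
    v * L (ι (suc m)) (v ^ suc m) + (v ^ suc m + v ^ suc m)     ≈⟨ +-congʳ (*-congˡ (L-v^suc m)) ⟩
    v * ((ι (suc m) + ι (suc m)) * v ^ m) + (v * v ^ m + v * v ^ m)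
      ≈⟨ solve 3 (λ v n p → v :* ((n :+ n) :* p) :+ (v :* p :+ v :* p) := (con 1 :+ n :+ (con 1 :+ n)) :* (v :* p))
           refl v (ι (suc m)) (v ^ m) ⟩
    (1# + ι (suc m) + (1# + ι (suc m))) * (v * v ^ m)           ∎

  L-v^ : ∀ m → Kp m (L (ι m) (v ^ m))
  L-v^ zero    = Level.lift L-v^0
  L-v^ (suc m) = mono 0 m (S-ι (suc m +ℕ suc m)) ≡.refl (trans (L-v^suc m)
    (*-cong (sym (ι-+ (suc m) (suc m))) (sym (*-identityˡ _))))

  open Closed (*-identityʳ v) v^-* L-v^ public

-- Positivity of integers and their reciprocals

module OrderedFieldProperties {c ℓ₁ ℓ₂} (F : OrderedField c ℓ₁ ℓ₂) where
  open OrderedField F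
  open IsTotalOrder isTotalOrder public using (antisym; total; ≤-respˡ-≈; ≤-respʳ-≈) renaming (trans to ≤-trans; refl to ≤-refl)
  open import Algebra.Properties.Ring ring using (-‿involutive; -1*x≈-x; -‿distribʳ-*)

  +-nonneg : ∀ {x y} → 0# ≤ x → 0# ≤ y → 0# ≤ (x + y)
  +-nonneg {x} {y} 0≤x 0≤y = ≤-trans 0≤y (≤-respˡ-≈ (+-identityˡ y) (+-mono-≤ y 0≤x))

  neg-nonneg : ∀ {x} → x ≤ 0# → 0# ≤ (- x)
  neg-nonneg {x} x≤0 = ≤-respʳ-≈ (+-identityˡ _) (≤-respˡ-≈ (-‿inverseʳ x) (+-mono-≤ (- x) x≤0))

  0≤1 : 0# ≤ 1#
  0≤1 with total 0# 1#
  ... | inj₁ 0≤1 = 0≤1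
  ... | inj₂ 1≤0 = ≤-respʳ-≈ (trans (-1*x≈-x (- 1#)) (-‿involutive 1#)) (*-nonneg (neg-nonneg 1≤0) (neg-nonneg 1≤0))

  fromℕ-nonneg : ∀ n → 0# ≤ fromℕ F n
  fromℕ-nonneg zero    = ≤-refl
  fromℕ-nonneg (suc n) = +-nonneg 0≤1 (fromℕ-nonneg n)

  fromℕ-suc≉0 : ∀ n → ¬ (fromℕ F (suc n) ≈ 0#)
  fromℕ-suc≉0 n eq = 1≉0 (antisym 1≤0 0≤1)
    where
    1≤0 : 1# ≤ 0#
    1≤0 = ≤-respʳ-≈ (trans (+-comm _ _) eq) (≤-respˡ-≈ (+-identityˡ 1#) (+-mono-≤ 1# (fromℕ-nonneg n)))

  recip : ℕ → Carrier
  recip n = proj₁ (inverse (fromℕ F (suc n)) (fromℕ-suc≉0 n))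

  recip-inverse : ∀ n → recip n * fromℕ F (suc n) ≈ 1#
  recip-inverse n = trans (*-comm _ _) (proj₂ (inverse (fromℕ F (suc n)) (fromℕ-suc≉0 n)))

  -- Otherwise -1, which is n + 1 times the negated reciprocal, would be nonnegative.
  recip-nonneg : ∀ n → 0# ≤ recip n
  recip-nonneg n with total 0# (recip n)
  ... | inj₁ 0≤r = 0≤r
  ... | inj₂ r≤0 = ⊥-elim (1≉0 (antisym 1≤0 0≤1))
    where
    0≤-1 : 0# ≤ (- 1#)
    0≤-1 = ≤-respʳ-≈
      (trans (sym (-‿distribʳ-* _ _)) (-‿cong (trans (*-comm _ _) (recip-inverse n))))
      (*-nonneg (fromℕ-nonneg (suc n)) (neg-nonneg r≤0))
    1≤0 : 1# ≤ 0#
    1≤0 = ≤-respˡ-≈ (+-identityˡ 1#) (≤-respʳ-≈ (-‿inverseˡ 1#) (+-mono-≤ 1# 0≤-1))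

  fromℕ-+ : ∀ m n → fromℕ F (m +ℕ n) ≈ fromℕ F m + fromℕ F n
  fromℕ-+ zero    n = sym (+-identityˡ _)
  fromℕ-+ (suc m) n = trans (+-congˡ (fromℕ-+ m n)) (sym (+-assoc _ _ _))

-- Finite sums, Cauchy products and evaluation

module Sums {c ℓ₁ ℓ₂} (F : OrderedField c ℓ₁ ℓ₂) where
  open OrderedField F
  open import Algebra.Solver.Ring.NaturalCoefficients.Default commutativeSemiring
  open import Relation.Binary.Reasoning.Setoid setoid

  sumTo-cong : ∀ n {f g} → (∀ i → f i ≈ g i) → sumTo F n f ≈ sumTo F n g
  sumTo-cong zero    f≈g = refl
  sumTo-cong (suc n) f≈g = +-cong (sumTo-cong n f≈g) (f≈g n)

  sumTo-0 : ∀ n {f} → (∀ i → f i ≈ 0#) → sumTo F n f ≈ 0#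
  sumTo-0 zero    f≈0 = refl
  sumTo-0 (suc n) f≈0 = trans (+-cong (sumTo-0 n f≈0) (f≈0 n)) (+-identityˡ 0#)

  sumTo-+ : ∀ n f g → sumTo F n (λ i → f i + g i) ≈ sumTo F n f + sumTo F n g
  sumTo-+ zero    f g = sym (+-identityˡ 0#)
  sumTo-+ (suc n) f g = trans (+-congʳ (sumTo-+ n f g))
    (solve 4 (λ a b c d → (a :+ b) :+ (c :+ d) := (a :+ c) :+ (b :+ d)) refl _ _ _ _)

  sumTo-* : ∀ n a f → sumTo F n (λ i → a * f i) ≈ a * sumTo F n f
  sumTo-* zero    a f = sym (zeroʳ a)
  sumTo-* (suc n) a f = trans (+-congʳ (sumTo-* n a f)) (sym (distribˡ a _ _))

  sumTo-head : ∀ n f → sumTo F (suc n) f ≈ f 0 + sumTo F n (f ∘ suc)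
  sumTo-head zero    f = +-comm _ _
  sumTo-head (suc n) f = trans (+-congʳ (sumTo-head n f)) (+-assoc _ _ _)

  mul-cong : ∀ {p p′ q q′} → (∀ k → p k ≈ p′ k) → (∀ k → q k ≈ q′ k) → ∀ n → mul F p q n ≈ mul F p′ q′ n
  mul-cong p≈ q≈ n = sumTo-cong (suc n) (λ i → *-cong (p≈ i) (q≈ (n ℕ.∸ i)))

  mul-congʳ : ∀ q {p p′} → (∀ k → p k ≈ p′ k) → ∀ n → mul F p q n ≈ mul F p′ q n
  mul-congʳ q p≈ = mul-cong {q = q} p≈ (λ _ → refl)

  mul-zero : ∀ p q → mul F p q 0 ≈ p 0 * q 0
  mul-zero p q = +-identityˡ _

  mul-suc : ∀ p q n → mul F p q (suc n) ≈ p 0 * q (suc n) + mul F (p ∘ suc) q n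
  mul-suc p q n = sumTo-head (suc n) _

  mul-sucʳ : ∀ p q n → mul F p q (suc n) ≈ mul F p (q ∘ suc) n + p (suc n) * q 0
  mul-sucʳ p q zero    = +-congʳ (+-congˡ refl)
  mul-sucʳ p q (suc n) = begin
    mul F p q (suc (suc n))                                                      ≈⟨ mul-suc p q (suc n) ⟩
    p 0 * q (suc (suc n)) + mul F (p ∘ suc) q (suc n)                            ≈⟨ +-congˡ (mul-sucʳ (p ∘ suc) q n) ⟩
    p 0 * q (suc (suc n)) + (mul F (p ∘ suc) (q ∘ suc) n + p (suc (suc n)) * q 0) ≈⟨ +-assoc _ _ _ ⟨
    p 0 * q (suc (suc n)) + mul F (p ∘ suc) (q ∘ suc) n + p (suc (suc n)) * q 0  ≈⟨ +-congʳ (mul-suc p (q ∘ suc) n) ⟨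
    mul F p (q ∘ suc) (suc n) + p (suc (suc n)) * q 0                            ∎

  mul-comm : ∀ p q n → mul F p q n ≈ mul F q p n
  mul-comm p q zero    = +-congˡ (*-comm _ _)
  mul-comm p q (suc n) = begin
    mul F p q (suc n)                         ≈⟨ mul-suc p q n ⟩
    p 0 * q (suc n) + mul F (p ∘ suc) q n     ≈⟨ +-cong (*-comm _ _) (mul-comm (p ∘ suc) q n) ⟩
    q (suc n) * p 0 + mul F q (p ∘ suc) n     ≈⟨ +-comm _ _ ⟩
    mul F q (p ∘ suc) n + q (suc n) * p 0     ≈⟨ mul-sucʳ q p n ⟨
    mul F q p (suc n)                         ∎

  mul-distribʳ : ∀ r p q n → mul F (λ k → p k + q k) r n ≈ mul F p r n + mul F q r n
  mul-distribʳ r p q n = trans (sumTo-cong (suc n) (λ i → distribʳ _ _ _)) (sumTo-+ (suc n) _ _)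

  mul-scale : ∀ a p q n → mul F (λ k → a * p k) q n ≈ a * mul F p q n
  mul-scale a p q n = trans (sumTo-cong (suc n) (λ i → *-assoc _ _ _)) (sumTo-* (suc n) a _)

  mul-0 : ∀ {p} q n → (∀ k → p k ≈ 0#) → mul F p q n ≈ 0#
  mul-0 q n p≈0 = sumTo-0 (suc n) (λ i → trans (*-congʳ (p≈0 i)) (zeroˡ _))

  mul-assoc : ∀ p q r n → mul F (mul F p q) r n ≈ mul F p (mul F q r) n
  mul-assoc p q r zero    = solve 3 (λ a b c → con 0 :+ (con 0 :+ a :* b) :* c := con 0 :+ a :* (con 0 :+ b :* c)) refl _ _ _
  mul-assoc p q r (suc n) = begin
    mul F (mul F p q) r (suc n)                          ≈⟨ mul-suc (mul F p q) r n ⟩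
    mul F p q 0 * r (suc n) + mul F (mul F p q ∘ suc) r n
      ≈⟨ +-cong (*-congʳ (mul-zero p q)) (mul-congʳ r (mul-suc p q) n) ⟩
    p 0 * q 0 * r (suc n) + mul F (λ k → p 0 * q (suc k) + mul F (p ∘ suc) q k) r n
      ≈⟨ +-congˡ (trans (mul-distribʳ r _ _ n) (+-cong (mul-scale (p 0) (q ∘ suc) r n) (mul-assoc (p ∘ suc) q r n))) ⟩
    p 0 * q 0 * r (suc n) + (p 0 * mul F (q ∘ suc) r n + mul F (p ∘ suc) (mul F q r) n)
      ≈⟨ solve 5 (λ a b c d e → a :* b :* c :+ (a :* d :+ e) := a :* (b :* c :+ d) :+ e) refl _ _ _ _ _ ⟩
    p 0 * (q 0 * r (suc n) + mul F (q ∘ suc) r n) + mul F (p ∘ suc) (mul F q r) n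
      ≈⟨ +-congʳ (*-congˡ (mul-suc q r n)) ⟨
    p 0 * mul F q r (suc n) + mul F (p ∘ suc) (mul F q r) n   ≈⟨ mul-suc p (mul F q r) n ⟨
    mul F p (mul F q r) (suc n)                               ∎

  mul-shift : ∀ p q n → mul F (shift F p) q n ≈ shift F (mul F p q) n
  mul-shift p q zero    = trans (+-identityˡ _) (zeroˡ _)
  mul-shift p q (suc n) = trans (mul-suc (shift F p) q n) (trans (+-congʳ (zeroˡ _)) (+-identityˡ _))

  shift-cong : ∀ {p q} → (∀ k → p k ≈ q k) → ∀ k → shift F p k ≈ shift F q k
  shift-cong p≈q zero    = refl
  shift-cong p≈q (suc k) = p≈q k

  constant : Carrier → Poly F
  constant a zero    = a
  constant a (suc k) = 0#

  mul-constant : ∀ a p n → mul F (constant a) p n ≈ a * p n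
  mul-constant a p zero    = +-identityˡ _
  mul-constant a p (suc n) = trans (mul-suc (constant a) p n) (trans (+-congˡ (mul-0 p n (λ _ → refl))) (+-identityʳ _))

  eval : ℕ → Poly F → Carrier → Carrier
  eval n p t = sumTo F n (λ i → p i * pow F t i)

  eval-cong : ∀ n {p q} t → (∀ k → p k ≈ q k) → eval n p t ≈ eval n q t
  eval-cong n t p≈q = sumTo-cong n (λ i → *-congʳ (p≈q i))

  eval-+ : ∀ n p q t → eval n (λ k → p k + q k) t ≈ eval n p t + eval n q t
  eval-+ n p q t = trans (sumTo-cong n (λ i → distribʳ _ _ _)) (sumTo-+ n _ _)

  eval-* : ∀ n a p t → eval n (λ k → a * p k) t ≈ a * eval n p t
  eval-* n a p t = trans (sumTo-cong n (λ i → *-assoc _ _ _)) (sumTo-* n a _)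

  eval-0 : ∀ n {p} t → (∀ k → p k ≈ 0#) → eval n p t ≈ 0#
  eval-0 n t p≈0 = sumTo-0 n (λ i → trans (*-congʳ (p≈0 i)) (zeroˡ _))

  eval-suc : ∀ n p t → eval (suc n) p t ≈ p 0 + t * eval n (p ∘ suc) t
  eval-suc n p t = trans (sumTo-head n _) (+-cong (*-identityʳ _)
    (trans (sumTo-cong n (λ i → solve 3 (λ a b c → a :* (b :* c) := b :* (a :* c)) refl _ _ _)) (sumTo-* n t _)))

  eval-stable : ∀ n e {p} t → (∀ k → e ℕ.≤ k → p k ≈ 0#) → eval (n +ℕ e) p t ≈ eval e p t
  eval-stable zero    e t p≈0 = refl
  eval-stable (suc n) e t p≈0 = trans (+-cong (eval-stable n e t p≈0)
    (trans (*-congʳ (p≈0 (n +ℕ e) (ℕₚ.m≤n+m e n))) (zeroˡ _))) (+-identityʳ _)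

  -- Induction on p by splitting off its constant term. Here n counts the coefficients of p, while e
  -- bounds the degree of q, so that n + e counts those of the product even for n = 0.
  eval-mul : ∀ n e {p q} t → (∀ k → n ℕ.≤ k → p k ≈ 0#) → (∀ k → suc e ℕ.≤ k → q k ≈ 0#) →
             eval (n +ℕ e) (mul F p q) t ≈ eval n p t * eval (suc e) q t
  eval-mul zero    e {p} {q} t p≈0 q≈0 = trans (eval-0 e t (λ k → mul-0 q k (λ i → p≈0 i z≤n))) (sym (zeroˡ _))
  eval-mul (suc n) e {p} {q} t p≈0 q≈0 = begin
    eval (suc (n +ℕ e)) (mul F p q) t                                ≈⟨ eval-cong (suc (n +ℕ e)) t split ⟩
    eval (suc (n +ℕ e)) (λ k → p 0 * q k + shift F (mul F p′ q) k) t  ≈⟨ eval-+ (suc (n +ℕ e)) _ _ t ⟩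
    eval (suc (n +ℕ e)) (λ k → p 0 * q k) t + eval (suc (n +ℕ e)) (shift F (mul F p′ q)) t
      ≈⟨ +-cong (eval-* (suc (n +ℕ e)) (p 0) q t) (trans (eval-suc (n +ℕ e) _ t) (+-identityˡ _)) ⟩
    p 0 * eval (suc (n +ℕ e)) q t + t * eval (n +ℕ e) (mul F p′ q) t
      ≈⟨ +-cong (*-congˡ (trans (reflexive (≡.cong (λ m → eval m q t) (≡.sym (ℕₚ.+-suc n e)))) (eval-stable n (suc e) t q≈0)))
                (*-congˡ (eval-mul n e t (λ k n≤k → p≈0 (suc k) (s≤s n≤k)) q≈0)) ⟩
    p 0 * eval (suc e) q t + t * (eval n p′ t * eval (suc e) q t)
      ≈⟨ solve 4 (λ a b c d → a :* b :+ c :* (d :* b) := (a :+ c :* d) :* b) refl _ _ _ _ ⟩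
    (p 0 + t * eval n p′ t) * eval (suc e) q t                       ≈⟨ *-congʳ (eval-suc n p t) ⟨
    eval (suc n) p t * eval (suc e) q t                              ∎
    where
    p′ = p ∘ suc
    split : ∀ k → mul F p q k ≈ p 0 * q k + shift F (mul F p′ q) k
    split zero    = trans (+-identityˡ _) (sym (+-identityʳ _))
    split (suc k) = mul-suc p q k

-- Power series as a differential ring

module Series {c ℓ₁ ℓ₂} (F : OrderedField c ℓ₁ ℓ₂) where
  open OrderedField F
  open OrderedFieldProperties F
  open Sums F
  open import Algebra.Properties.Ring ring using (-0#≈0#; -‿+-comm)
  open import Algebra.Solver.Ring.NaturalCoefficients.Default commutativeSemiring
  open import Relation.Binary.Reasoning.Setoid setoid

  one : Poly F
  one = constant 1#

  one-mul : ∀ p n → mul F one p n ≈ p n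
  one-mul p n = trans (mul-constant 1# p n) (*-identityˡ _)

  seriesRing : CommutativeRing c ℓ₁
  seriesRing = record
    { Carrier = Poly F
    ; _≈_     = λ p q → ∀ k → p k ≈ q k
    ; _+_     = λ p q k → p k + q k
    ; _*_     = mul F
    ; -_      = λ p k → - p k
    ; 0#      = λ _ → 0#
    ; 1#      = one
    ; isCommutativeRing = record
      { isRing = record
        { +-isAbelianGroup = Pointwise.isAbelianGroup ℕ +-isAbelianGroup
        ; *-cong           = mul-cong
        ; *-assoc          = mul-assoc
        ; *-identity       = one-mul , λ p n → trans (mul-comm p one n) (one-mul p n)
        ; distrib          = (λ r p q n → trans (mul-comm r _ n) (trans (mul-distribʳ r p q n) (+-cong (mul-comm p r n) (mul-comm q r n))))
                           , mul-distribʳ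
        }
      ; *-comm = mul-comm
      }
    }

  module 𝓡 = CommutativeRing seriesRing

  X : Poly F
  X = shift F one

  X-mul : ∀ p n → mul F X p n ≈ shift F p n
  X-mul p n = trans (mul-shift one p n) (shift-cong (one-mul p) n)

  -- `θ` is the Euler operator x d/dx. It does not move coefficients, so Leibniz's rule is proved
  -- for it and then read off for `∂` one index higher.
  θ ∂ : Poly F → Poly F
  θ p k = fromℕ F k * p k
  ∂ p k = θ p (suc k)

  θ-mul : ∀ p q n → θ (mul F p q) n ≈ mul F (θ p) q n + mul F p (θ q) n
  θ-mul p q zero = solve 2 (λ a b → con 0 :* (con 0 :+ a :* b) := (con 0 :+ con 0 :* a :* b) :+ (con 0 :+ a :* (con 0 :* b))) refl _ _
  θ-mul p q (suc n) = begin
    fromℕ F (suc n) * mul F p q (suc n)                                  ≈⟨ *-congˡ (mul-suc p q n) ⟩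
    (1# + fromℕ F n) * (p 0 * q (suc n) + mul F p′ q n)
      ≈⟨ solve 4 (λ m a b s → (con 1 :+ m) :* (a :* b :+ s)
            := (con 0 :* a :* b :+ s) :+ a :* ((con 1 :+ m) :* b) :+ m :* s) refl _ _ _ _ ⟩
    (0# * p 0 * q (suc n) + mul F p′ q n) + p 0 * θ q (suc n) + θ (mul F p′ q) n
      ≈⟨ +-congˡ (θ-mul p′ q n) ⟩
    (0# * p 0 * q (suc n) + mul F p′ q n) + p 0 * θ q (suc n) + (mul F (θ p′) q n + mul F p′ (θ q) n)
      ≈⟨ solve 5 (λ a b c d e → (a :+ b) :+ c :+ (d :+ e) := (a :+ (b :+ d)) :+ (c :+ e)) refl _ _ _ _ _ ⟩
    (0# * p 0 * q (suc n) + (mul F p′ q n + mul F (θ p′) q n)) + (p 0 * θ q (suc n) + mul F p′ (θ q) n)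
      ≈⟨ +-cong (+-congˡ (trans (sym (mul-distribʳ q p′ (θ p′) n)) (mul-congʳ q θ-suc n))) (sym (mul-suc p (θ q) n)) ⟩
    (0# * p 0 * q (suc n) + mul F (∂ p) q n) + mul F p (θ q) (suc n)     ≈⟨ +-congʳ (mul-suc (θ p) q n) ⟨
    mul F (θ p) q (suc n) + mul F p (θ q) (suc n)                        ∎
    where
    p′ = p ∘ suc
    θ-suc : ∀ k → p′ k + θ p′ k ≈ ∂ p k
    θ-suc k = solve 2 (λ m a → a :+ m :* a := (con 1 :+ m) :* a) refl _ _

  ∂-mul : ∀ p q n → ∂ (mul F p q) n ≈ mul F (∂ p) q n + mul F p (∂ q) n
  ∂-mul p q n = trans (θ-mul p q (suc n)) (+-cong
    (trans (mul-suc (θ p) q n) (solve 3 (λ a b s → con 0 :* a :* b :+ s := s) refl _ _ _))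
    (trans (mul-sucʳ p (θ q) n) (solve 3 (λ a b s → s :+ a :* (con 0 :* b) := s) refl _ _ _)))

  X∂≈θ : ∀ p n → mul F X (∂ p) n ≈ θ p n
  X∂≈θ p zero    = trans (X-mul (∂ p) 0) (sym (zeroˡ _))
  X∂≈θ p (suc n) = X-mul (∂ p) (suc n)

  𝒟 : Derivation seriesRing
  𝒟 = record
    { ∂      = ∂
    ; ∂-cong = λ p≈q k → *-congˡ (p≈q (suc k))
    ; ∂-+    = λ p q k → distribˡ _ _ _
    ; ∂-*    = ∂-mul
    ; x      = X
    ; ω      = λ k → one k - X k
    ; ∂x≈1   = λ { zero → solve 0 ((con 1 :+ con 0) :* con 1 := con 1) refl ; (suc k) → zeroʳ _ }
    ; ω+x≈1  = λ k → trans (+-assoc _ _ _) (trans (+-congˡ (-‿inverseˡ _)) (+-identityʳ _))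
    }

  open Derivation 𝒟 public using (ω)
  module J = Jets 𝒟
  open J public using (ι; _^_)

  ∂-constant : ∀ {p a} → p 𝓡.≈ constant a → ∂ p 𝓡.≈ 𝓡.0#
  ∂-constant p≈ k = trans (*-congˡ (p≈ (suc k))) (zeroʳ _)

  ι≈constant : ∀ n → ι n 𝓡.≈ constant (fromℕ F n)
  ι≈constant zero    zero    = refl
  ι≈constant zero    (suc k) = refl
  ι≈constant (suc n) zero    = +-congˡ (ι≈constant n 0)
  ι≈constant (suc n) (suc k) = trans (+-identityˡ _) (ι≈constant n (suc k))

  constant-* : ∀ a b k → mul F (constant a) (constant b) k ≈ constant (a * b) k
  constant-* a b zero    = +-identityˡ _
  constant-* a b (suc k) = trans (mul-constant a (constant b) (suc k)) (zeroʳ a)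

  constant-cong : ∀ {a b} → a ≈ b → constant a 𝓡.≈ constant b
  constant-cong a≈b zero    = a≈b
  constant-cong a≈b (suc k) = refl

  nonnegConstants : NonnegConstants 𝒟 (c ⊔ ℓ₁ ⊔ ℓ₂)
  nonnegConstants = record
    { S     = λ p → Σ Carrier λ a → 0# ≤ a × p 𝓡.≈ constant a
    ; S-*   = λ { (a , 0≤a , p≈) (b , 0≤b , q≈) → a * b , *-nonneg 0≤a 0≤b , λ k → trans (mul-cong p≈ q≈ k) (constant-* a b k) }
    ; S-ι   = λ n → fromℕ F n , fromℕ-nonneg n , ι≈constant n
    ; ∂S≈0  = λ { (a , _ , p≈) → ∂-constant p≈ }
    ; inv   = λ n → constant (recip n)
    ; S-inv = λ n → recip n , recip-nonneg n , λ _ → refl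
    ; inv-ι = λ n k → trans (mul-cong {constant (recip n)} (λ _ → refl) (ι≈constant (suc n)) k)
                       (trans (constant-* _ _ k) (constant-cong (recip-inverse n) k))
    }

  open NonnegConstants nonnegConstants public using (S)

  ω-mul-zero : ∀ p → mul F ω p 0 ≈ p 0
  ω-mul-zero p = trans (+-identityˡ _) (trans (*-congʳ (trans (+-congˡ -0#≈0#) (+-identityʳ 1#))) (*-identityˡ _))

  ω-mul-suc : ∀ p n → mul F ω p (suc n) ≈ p (suc n) - p n
  ω-mul-suc p n = +-cancelʳ (p n) _ _ (begin
    mul F ω p (suc n) + p n                   ≈⟨ +-congˡ (X-mul p (suc n)) ⟨
    mul F ω p (suc n) + mul F X p (suc n)     ≈⟨ mul-distribʳ p ω X (suc n) ⟨
    mul F (ω 𝓡.+ X) p (suc n)                 ≈⟨ mul-congʳ p (Derivation.ω+x≈1 𝒟) (suc n) ⟩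
    mul F one p (suc n)                       ≈⟨ one-mul p (suc n) ⟩
    p (suc n)                                 ≈⟨ +-identityʳ _ ⟨
    p (suc n) + 0#                            ≈⟨ +-congˡ (-‿inverseˡ (p n)) ⟨
    p (suc n) + (- p n + p n)                 ≈⟨ +-assoc _ _ _ ⟨
    p (suc n) - p n + p n                     ∎)
    where open import Algebra.Properties.Ring ring using (+-cancelʳ)

  geo : Poly F
  geo _ = 1#

  ω*geo≈1 : mul F ω geo 𝓡.≈ one
  ω*geo≈1 zero    = ω-mul-zero geo
  ω*geo≈1 (suc n) = trans (ω-mul-suc geo n) (-‿inverseʳ 1#)

  signed-cong : ∀ i {a b} → a ≈ b → signed F i a ≈ signed F i b
  signed-cong zero    a≈b = a≈b
  signed-cong (suc i) a≈b = -‿cong (signed-cong i a≈b)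

  signed-0 : ∀ i → signed F i 0# ≈ 0#
  signed-0 zero    = refl
  signed-0 (suc i) = trans (-‿cong (signed-0 i)) -0#≈0#

  signed-+ : ∀ i a b → signed F i (a + b) ≈ signed F i a + signed F i b
  signed-+ zero    a b = refl
  signed-+ (suc i) a b = trans (-‿cong (signed-+ i a b)) (sym (-‿+-comm _ _))

  choose-0 : ∀ n → choose n 0 ≡ 1
  choose-0 zero    = ≡.refl
  choose-0 (suc n) = ≡.refl

  -- Multiplication by `ω` takes differences of neighbouring coefficients, which with alternating
  -- signs is Pascal's rule. So the alternating sum in `W` is a Cauchy product.
  ω^-coefficient : ∀ n i → (ω ^ n) i ≈ signed F i (fromℕ F (choose n i))
  ω^-coefficient zero    zero    = sym (+-identityʳ 1#)
  ω^-coefficient zero    (suc i) = sym (signed-0 (suc i))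
  ω^-coefficient (suc n) zero    = trans (ω-mul-zero (ω ^ n)) (trans (ω^-coefficient n 0) (reflexive (≡.cong (fromℕ F) (choose-0 n))))
  ω^-coefficient (suc n) (suc i) = begin
    mul F ω (ω ^ n) (suc i)        ≈⟨ ω-mul-suc (ω ^ n) i ⟩
    (ω ^ n) (suc i) - (ω ^ n) i    ≈⟨ +-cong (ω^-coefficient n (suc i)) (-‿cong (ω^-coefficient n i)) ⟩
    signed F (suc i) (fromℕ F (choose n (suc i))) + signed F (suc i) (fromℕ F (choose n i))  ≈⟨ +-comm _ _ ⟩
    signed F (suc i) (fromℕ F (choose n i)) + signed F (suc i) (fromℕ F (choose n (suc i)))  ≈⟨ signed-+ (suc i) _ _ ⟨
    signed F (suc i) (fromℕ F (choose n i) + fromℕ F (choose n (suc i)))  ≈⟨ signed-cong (suc i) (fromℕ-+ (choose n i) (choose n (suc i))) ⟨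
    signed F (suc i) (fromℕ F (choose (suc n) (suc i)))                   ∎

  W≈ : ∀ d p → W F d p 𝓡.≈ J.𝒲 d (evalAt F d p)
  W≈ d p = mul-congʳ (evalAt F d p) (λ i → sym (ω^-coefficient (suc d) i))

  -- Horner's scheme: `p ∘ suc` is (p(t) - p(0)) / t, and multiplying the value at j by j is x d/dx
  -- on generating functions.
  multiplier : ∀ d p → J.Multiplier d (evalAt F d p) (λ Q j → evalAt F d p j * Q j)
  multiplier zero p = Horner.constant (∂-constant {constant (p 0)} (λ _ → refl))
    (λ j → trans (eval₀ j) (sym (trans (mul-constant _ geo j) (*-identityʳ _))))
    (λ Q j → trans (*-congʳ (eval₀ j)) (sym (mul-constant _ Q j)))
    where
    module Horner = J.Horner {geo} ω*geo≈1
    eval₀ : ∀ j → evalAt F 0 p j ≈ p 0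
    eval₀ j = trans (+-identityˡ _) (*-identityʳ _)
  multiplier (suc d) p = Horner.step (∂-constant {constant (p 0)} (λ _ → refl)) (multiplier d (p ∘ suc))
    (λ j → trans (eval₊ j) (+-cong (sym (trans (mul-constant _ geo j) (*-identityʳ _))) (sym (X∂≈θ (evalAt F d (p ∘ suc)) j))))
    (λ Q j → trans (*-congʳ (eval₊ j)) (trans
      (solve 4 (λ a t b q → (a :+ t :* b) :* q := a :* q :+ t :* (b :* q)) refl _ _ _ _)
      (+-cong (sym (mul-constant _ Q j)) (sym (X∂≈θ (λ i → evalAt F d (p ∘ suc) i * Q i) j)))))
    where
    module Horner = J.Horner {geo} ω*geo≈1
    eval₊ : ∀ j → evalAt F (suc d) p j ≈ p 0 + fromℕ F j * evalAt F d (p ∘ suc) j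
    eval₊ j = eval-suc (suc d) p (fromℕ F j)

  W-mul : ∀ {d e p q} → HasDegree F d p → HasDegree F e q →
          W F (d +ℕ e) (mul F p q) 𝓡.≈ J.𝒲 (d +ℕ e) (λ j → evalAt F d p j * evalAt F e q j)
  W-mul {d} {e} {p} {q} (_ , p≈0) (_ , q≈0) = 𝓡.trans (W≈ (d +ℕ e) (mul F p q))
    (𝓡.*-congˡ {x = ω ^ suc (d +ℕ e)} (λ j → eval-mul (suc d) e (fromℕ F j) p≈0 q≈0))

-- Palindromic and γ-positive coefficient sequences as members of the cones

module Coefficients {c ℓ₁ ℓ₂} (F : OrderedField c ℓ₁ ℓ₂) where
  open OrderedField F
  open OrderedFieldProperties F
  open Sums F
  open Series F
  open import Algebra.Solver.Ring.NaturalCoefficients.Default commutativeSemiring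
  open import Relation.Binary.Reasoning.Setoid setoid

  -- Indices are paired by their sum, so that shifts need no truncated subtraction.
  Symmetric : ℕ → Poly F → Set ℓ₁
  Symmetric d p = (∀ k → d ℕ.< k → p k ≈ 0#) × (∀ i j → i +ℕ j ≡ d → p i ≈ p j)

  Symmetric⇒Palin : ∀ {d p} → Symmetric d p → Palin F d p
  Symmetric⇒Palin (p≈0 , sym-p) = p≈0 , λ k k≤d → sym-p k _ (ℕₚ.m+[n∸m]≡n k≤d)

  Symmetric-+ : ∀ {d p q} → Symmetric d p → Symmetric d q → Symmetric d (p 𝓡.+ q)
  Symmetric-+ (p≈0 , sym-p) (q≈0 , sym-q) =
    (λ k d<k → trans (+-cong (p≈0 k d<k) (q≈0 k d<k)) (+-identityˡ 0#)) ,
    (λ i j eq → +-cong (sym-p i j eq) (sym-q i j eq))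

  Symmetric-resp : ∀ {d p q} → p 𝓡.≈ q → Symmetric d p → Symmetric d q
  Symmetric-resp p≈q (p≈0 , sym-p) =
    (λ k d<k → trans (sym (p≈q k)) (p≈0 k d<k)) ,
    (λ i j eq → trans (sym (p≈q i)) (trans (sym-p i j eq) (p≈q j)))

  Symmetric-scale : ∀ {d p} a → Symmetric d p → Symmetric d (λ k → a * p k)
  Symmetric-scale a (p≈0 , sym-p) =
    (λ k d<k → trans (*-congˡ (p≈0 k d<k)) (zeroʳ a)) , (λ i j eq → *-congˡ (sym-p i j eq))

  -- Reflection in degree d + 1 exchanges the forms x p and y p. This serves both x y p and (x + y)
  -- p.
  shift-reflect : ∀ {d p} → Symmetric d p → ∀ i j → i +ℕ j ≡ suc d → shift F p i ≈ p j
  shift-reflect (p≈0 , _)   zero    j eq = sym (p≈0 j (ℕₚ.≤-reflexive (≡.sym eq)))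
  shift-reflect (_ , sym-p) (suc i) j eq = sym-p i j (ℕₚ.suc-injective eq)

  Symmetric-shift : ∀ {d p} → Symmetric d p → Symmetric (suc (suc d)) (shift F p)
  Symmetric-shift {d} {p} P@(p≈0 , sym-p) = (λ { (suc k) (s≤s d<k) → p≈0 k (ℕₚ.<-trans (ℕₚ.n<1+n d) d<k) }) , reflect
    where
    reflect : ∀ i j → i +ℕ j ≡ suc (suc d) → shift F p i ≈ shift F p j
    reflect i zero    eq rewrite ≡.trans (≡.sym (ℕₚ.+-identityʳ i)) eq = p≈0 (suc d) ℕₚ.≤-refl
    reflect i (suc j) eq = shift-reflect P i j (ℕₚ.suc-injective (≡.trans (≡.sym (ℕₚ.+-suc i j)) eq))

  Symmetric-X^ : ∀ {d p} i → Symmetric d p → Symmetric (i +ℕ i +ℕ d) (mul F (X ^ i) p)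
  Symmetric-X^ {d} {p} zero    P = Symmetric-resp (λ k → sym (one-mul p k)) P
  Symmetric-X^ {d} {p} (suc i) P rewrite ℕₚ.+-suc i i = Symmetric-resp
    (λ k → sym (trans (mul-assoc X (X ^ i) p k) (X-mul (mul F (X ^ i) p) k))) (Symmetric-shift (Symmetric-X^ i P))

  v-mul : ∀ p k → mul F J.v p k ≈ p k + shift F p k
  v-mul p k = trans (mul-distribʳ p one X k) (+-cong (one-mul p k) (X-mul p k))

  Symmetric-v^ : ∀ m → Symmetric m (J.v ^ m)
  Symmetric-v^ zero = (λ { (suc k) _ → refl }) , λ { zero zero _ → refl }
  Symmetric-v^ (suc m) = Symmetric-resp (λ k → sym (v-mul (J.v ^ m) k))
    ( (λ { (suc k) (s≤s m<k) → trans (+-cong (v^≈0 (suc k) (ℕₚ.m<n⇒m<1+n m<k)) (v^≈0 k m<k)) (+-identityˡ 0#) })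
    , λ i j eq → trans (+-cong (sym (shift-reflect V j i (≡.trans (ℕₚ.+-comm j i) eq))) (shift-reflect V i j eq)) (+-comm _ _))
    where
    V = Symmetric-v^ m
    v^≈0 = proj₁ V

  -- Reflection in degree i + j exchanges the powers of x and y with that exponent; the latter is
  -- `one`.
  X^-reflect : ∀ i j → (X ^ (i +ℕ j)) i ≈ one j
  X^-reflect zero    zero    = refl
  X^-reflect zero    (suc j) = X-mul (X ^ j) 0
  X^-reflect (suc i) j       = trans (X-mul (X ^ (i +ℕ j)) (suc i)) (X^-reflect i j)

  X^-< : ∀ m k → k ℕ.< m → (X ^ m) k ≈ 0#
  X^-< (suc m) zero    _         = X-mul (X ^ m) 0
  X^-< (suc m) (suc k) (s≤s k<m) = trans (X-mul (X ^ m) (suc k)) (X^-< m k k<m)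

  X^-> : ∀ m k → m ℕ.< k → (X ^ m) k ≈ 0#
  X^-> zero    (suc k) _         = refl
  X^-> (suc m) (suc k) (s≤s m<k) = trans (X-mul (X ^ m) (suc k)) (X^-> m k m<k)

  one-nonneg : Nonneg F one
  one-nonneg zero    = 0≤1
  one-nonneg (suc k) = ≤-refl

  shift-nonneg : ∀ {p} → Nonneg F p → Nonneg F (shift F p)
  shift-nonneg P zero    = ≤-refl
  shift-nonneg P (suc k) = P k

  X^-mul-nonneg : ∀ i {p} → Nonneg F p → Nonneg F (mul F (X ^ i) p)
  X^-mul-nonneg zero    {p} P k = ≤-respʳ-≈ (sym (one-mul p k)) (P k)
  X^-mul-nonneg (suc i) {p} P k = ≤-respʳ-≈ (sym (trans (mul-assoc X (X ^ i) p k) (X-mul (mul F (X ^ i) p) k)))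
    (shift-nonneg (X^-mul-nonneg i P) k)

  S-mul : ∀ {κ} (κ∈ : S κ) p k → mul F κ p k ≈ proj₁ κ∈ * p k
  S-mul (a , _ , κ≈) p k = trans (mul-congʳ p κ≈ k) (mul-constant a p k)

  module _ (b : ℕ → Poly F) where
    open Cones nonnegConstants b

    Cone⇒Symmetric : (∀ m → Symmetric m (b m)) → ∀ {d p} → Cone d p → Symmetric d p
    Cone⇒Symmetric B (nil p≈0) = (λ k _ → p≈0 k) , λ i j _ → trans (p≈0 i) (sym (p≈0 j))
    Cone⇒Symmetric B (mono i m κ∈ ≡.refl p≈) = Symmetric-resp
      (λ k → sym (trans (p≈ k) (S-mul κ∈ (mul F (X ^ i) (b m)) k))) (Symmetric-scale _ (Symmetric-X^ i (B m)))
    Cone⇒Symmetric B (add u w p≈) = Symmetric-resp (λ k → sym (p≈ k)) (Symmetric-+ (Cone⇒Symmetric B u) (Cone⇒Symmetric B w))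

    Cone⇒Nonneg : (∀ m → Nonneg F (b m)) → ∀ {d p} → Cone d p → Nonneg F p
    Cone⇒Nonneg B (nil p≈0) k = ≤-respʳ-≈ (sym (p≈0 k)) ≤-refl
    Cone⇒Nonneg B (mono i m κ∈@(_ , 0≤a , _) _ p≈) k = ≤-respʳ-≈
      (sym (trans (p≈ k) (S-mul κ∈ (mul F (X ^ i) (b m)) k))) (*-nonneg 0≤a (X^-mul-nonneg i (B m) k))
    Cone⇒Nonneg B (add u w p≈) k = ≤-respʳ-≈ (sym (p≈ k)) (+-nonneg (Cone⇒Nonneg B u k) (Cone⇒Nonneg B w k))

    Kp⇒Palin-pred : (∀ m → Symmetric m (b m)) → ∀ d {p} → Kp d p → Palin-pred F d p
    Kp⇒Palin-pred B zero    (Level.lift p≈0) = p≈0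
    Kp⇒Palin-pred B (suc d) u = Symmetric⇒Palin (Cone⇒Symmetric B u)

  module Binomial where
    open BinomialCone nonnegConstants public

    b-symmetric : ∀ m → Symmetric m (b m)
    b-symmetric m =
      (λ { (suc k) m<k → trans (+-identityˡ _) (X^-> m (suc k) m<k) }) ,
      λ { i j ≡.refl → trans (+-congˡ (X^-reflect i j)) (trans (+-comm _ _) (+-congˡ (sym
        (trans (reflexive (≡.cong (λ n → (X ^ n) j) (ℕₚ.+-comm i j))) (X^-reflect j i))))) }

    b-nonneg : ∀ m → Nonneg F (b m)
    b-nonneg m k = +-nonneg (one-nonneg k) (≤-respʳ-≈ (𝓡.*-identityʳ (X ^ m) k) (X^-mul-nonneg m one-nonneg k))

    truncate : ℕ → Poly F → Poly F
    truncate zero    p k       = 0#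
    truncate (suc n) p zero    = p 0
    truncate (suc n) p (suc k) = truncate n (p ∘ suc) k

    truncate-< : ∀ n p k → k ℕ.< n → truncate n p k ≈ p k
    truncate-< (suc n) p zero    _         = refl
    truncate-< (suc n) p (suc k) (s≤s k<n) = truncate-< n (p ∘ suc) k k<n

    truncate-≥ : ∀ n p k → n ℕ.≤ k → truncate n p k ≈ 0#
    truncate-≥ zero    p k       _         = refl
    truncate-≥ (suc n) p (suc k) (s≤s n≤k) = truncate-≥ n (p ∘ suc) k n≤k

    truncate-nonneg : ∀ n {p} → Nonneg F p → Nonneg F (truncate n p)
    truncate-nonneg zero    P k       = ≤-refl
    truncate-nonneg (suc n) P zero    = P 0
    truncate-nonneg (suc n) P (suc k) = truncate-nonneg n (P ∘ suc) k

    mono₀ : ∀ {a} m {p} → 0# ≤ a → (∀ k → p k ≈ a * b m k) → Cone m p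
    mono₀ {a} m 0≤a p≈ = mono {κ = constant a} 0 m (a , 0≤a , λ _ → refl) ≡.refl
      (λ k → trans (p≈ k) (sym (trans (mul-constant a (mul F one (b m)) k) (*-congˡ (one-mul (b m) k)))))

    -- Splitting off p(0) (xᵈ + yᵈ) removes both outer coefficients by symmetry. What remains is x y
    -- times a symmetric form of degree d - 2, whose coefficients are inner coefficients of `p` and
    -- so nonnegative.
    Palin⇒Cone : ∀ d {p} → Palin F d p → Nonneg F p → Cone d p
    -- `b 0` is 1 + 1, hence the factor 1/2.
    Palin⇒Cone zero {p} (p≈0 , _) P = mono₀ 0 (*-nonneg (recip-nonneg 1) (P 0)) coefficient
      where
      coefficient : ∀ k → p k ≈ recip 1 * p 0 * b 0 k
      coefficient zero = begin
        p 0                                         ≈⟨ trans (*-congʳ (recip-inverse 1)) (*-identityˡ _) ⟨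
        recip 1 * (1# + (1# + 0#)) * p 0
          ≈⟨ solve 2 (λ r a → r :* (con 1 :+ (con 1 :+ con 0)) :* a := r :* a :* (con 1 :+ con 1)) refl _ _ ⟩
        recip 1 * p 0 * (1# + 1#)                   ∎
      coefficient (suc k) = trans (p≈0 (suc k) (s≤s z≤n)) (sym (trans (*-congˡ (+-identityˡ 0#)) (zeroʳ _)))
    Palin⇒Cone (suc zero) {p} (p≈0 , sym-p) P = mono₀ 1 (P 0) coefficient
      where
      coefficient : ∀ k → p k ≈ p 0 * b 1 k
      coefficient zero          = sym (trans (*-congˡ (trans (+-congˡ (X-mul one 0)) (+-identityʳ 1#))) (*-identityʳ _))
      coefficient (suc zero)    = trans (sym (sym-p 0 z≤n)) (sym (trans (*-congˡ (trans (+-congˡ (X-mul one 1)) (+-identityˡ 1#))) (*-identityʳ _)))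
      coefficient (suc (suc k)) = trans (p≈0 _ (s≤s (s≤s z≤n)))
        (sym (trans (*-congˡ (trans (+-congˡ (X-mul one (suc (suc k)))) (+-identityˡ 0#))) (zeroʳ _)))
    Palin⇒Cone (suc (suc d)) {p} (p≈0 , sym-p) P = add
      (mono₀ (suc (suc d)) (P 0) (λ _ → refl))
      (Kp-x (suc d) (Palin⇒Cone d (truncate-≥ (suc d) (p ∘ suc) , palin) (truncate-nonneg (suc d) (P ∘ suc))))
      (λ k → trans (coefficient k) (+-congˡ (sym (X-mul t k))))
      where
      t = truncate (suc d) (p ∘ suc)
      palin : ∀ k → k ℕ.≤ d → t k ≈ t (d ℕ.∸ k)
      palin k k≤d = begin
        t k                        ≈⟨ truncate-< (suc d) (p ∘ suc) k (s≤s k≤d) ⟩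
        p (suc k)                  ≈⟨ sym-p (suc k) (s≤s (ℕₚ.m≤n⇒m≤1+n k≤d)) ⟩
        p (suc d ℕ.∸ k)            ≈⟨ reflexive (≡.cong p (ℕₚ.+-∸-assoc 1 k≤d)) ⟩
        p (suc (d ℕ.∸ k))          ≈⟨ truncate-< (suc d) (p ∘ suc) (d ℕ.∸ k) (s≤s (ℕₚ.m∸n≤m d k)) ⟨
        t (d ℕ.∸ k)                ∎
      coefficient : ∀ k → p k ≈ p 0 * b (suc (suc d)) k + shift F t k
      coefficient zero = sym (trans (+-identityʳ _) (trans (*-congˡ (trans (+-congˡ (X-mul (X ^ suc d) 0)) (+-identityʳ 1#))) (*-identityʳ _)))
      coefficient (suc k) = trans (split (ℕₚ.<-cmp k (suc d)))
        (+-congʳ (*-congˡ (sym (trans (+-identityˡ _) (X-mul (X ^ suc d) (suc k))))))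
        where
        split : _ → p (suc k) ≈ p 0 * (X ^ suc d) k + t k
        split (tri< k<1+d _ _) = sym (trans (+-cong (trans (*-congˡ (X^-< (suc d) k k<1+d)) (zeroʳ _))
          (truncate-< (suc d) (p ∘ suc) k k<1+d)) (+-identityˡ _))
        -- The top coefficient of `p`, equal to `p 0`, which `truncate` has cut off.
        split (tri≈ _ ≡.refl _) = trans (trans (sym-p _ ℕₚ.≤-refl) (reflexive (≡.cong p (ℕₚ.n∸n≡0 d))))
          (sym (trans (+-cong (trans (*-congˡ X^-diagonal) (*-identityʳ _))
            (truncate-≥ (suc d) (p ∘ suc) k ℕₚ.≤-refl)) (+-identityʳ _)))
          where
          X^-diagonal : (X ^ suc d) (suc d) ≈ 1#
          X^-diagonal = trans (reflexive (≡.cong (λ n → (X ^ n) (suc d)) (≡.sym (ℕₚ.+-identityʳ (suc d))))) (X^-reflect (suc d) 0)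
        split (tri> _ _ d<k) = trans (p≈0 (suc k) (s≤s d<k))
          (sym (trans (+-cong (trans (*-congˡ (X^-> (suc d) k d<k)) (zeroʳ _))
            (truncate-≥ (suc d) (p ∘ suc) k (ℕₚ.<⇒≤ d<k))) (+-identityˡ 0#)))

    Palin-pred⇒Kp : ∀ d {p} → Palin-pred F d p → Nonneg F p → Kp d p
    Palin-pred⇒Kp zero    p≈0 _ = Level.lift p≈0
    Palin-pred⇒Kp (suc d) = Palin⇒Cone d

    NonnegSymDecomp⇒Decomposition : ∀ d {h} → NonnegSymDecomp F d h → Decomposition d h
    NonnegSymDecomp⇒Decomposition d (a , b′ , (h≈ , A , B) , a≥0 , b≥0) =
      a , b′ , Palin⇒Cone d A a≥0 , Palin-pred⇒Kp d B b≥0 , λ k → trans (h≈ k) (+-congˡ (sym (X-mul b′ k)))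

    Kp⇒Nonneg : ∀ d {p} → Kp d p → Nonneg F p
    Kp⇒Nonneg zero    (Level.lift p≈0) k = ≤-respʳ-≈ (sym (p≈0 k)) ≤-refl
    Kp⇒Nonneg (suc d) = Cone⇒Nonneg b b-nonneg

    Decomposition⇒NonnegSymDecomp : ∀ d {h} → Decomposition d h → NonnegSymDecomp F d h
    Decomposition⇒NonnegSymDecomp d (f , g , f∈ , g∈ , h≈) = f , g ,
      ((λ k → trans (h≈ k) (+-congˡ (X-mul g k))) , Symmetric⇒Palin (Cone⇒Symmetric b b-symmetric f∈) , Kp⇒Palin-pred b b-symmetric d g∈) ,
      Kp⇒Nonneg (suc d) f∈ , Kp⇒Nonneg d g∈

  module Gamma where
    open GammaCone nonnegConstants public

    v^-coefficient : ∀ m k → (J.v ^ m) k ≈ fromℕ F (choose m k)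
    v^-coefficient zero    zero    = sym (+-identityʳ 1#)
    v^-coefficient zero    (suc k) = refl
    v^-coefficient (suc m) zero    = trans (v-mul (J.v ^ m) 0) (trans (+-identityʳ _)
      (trans (v^-coefficient m 0) (reflexive (≡.cong (fromℕ F) (choose-0 m)))))
    v^-coefficient (suc m) (suc k) = trans (v-mul (J.v ^ m) (suc k)) (trans (+-comm _ _)
      (trans (+-cong (v^-coefficient m k) (v^-coefficient m (suc k))) (sym (fromℕ-+ (choose m k) (choose m (suc k))))))

    -- The local coefficient function of `gammaExp` with a free exponent `m`; at m = n - 2 i both
    -- agree by definition.
    coef : ℕ → ℕ → ℕ → ℕ
    coef i m k = if i ≤ᵇ k then choose m (k ℕ.∸ i) else 0

    -- `suc i ≤ᵇ suc k` unfolds to the left side, so this lowers both indices of `coef` by one.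
    <ᵇ-suc : ∀ i k → (i <ᵇ suc k) ≡ (i ≤ᵇ k)
    <ᵇ-suc zero    k = ≡.refl
    <ᵇ-suc (suc i) k = ≡.refl

    X^v^-coefficient : ∀ i m k → mul F (X ^ i) (J.v ^ m) k ≈ fromℕ F (coef i m k)
    X^v^-coefficient zero    m k = trans (one-mul (J.v ^ m) k) (v^-coefficient m k)
    X^v^-coefficient (suc i) m k = trans (mul-assoc X (X ^ i) (J.v ^ m) k)
      (trans (X-mul (mul F (X ^ i) (J.v ^ m)) k) (shifted k))
      where
      shifted : ∀ k → shift F (mul F (X ^ i) (J.v ^ m)) k ≈ fromℕ F (coef (suc i) m k)
      shifted zero    = refl
      shifted (suc k) = trans (X^v^-coefficient i m k)
        (reflexive (≡.cong (λ t → fromℕ F (if t then choose m (k ℕ.∸ i) else 0)) (≡.sym (<ᵇ-suc i k))))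

    GammaPos⇒Cone : ∀ d {p} → GammaPos F d p → Cone d p
    GammaPos⇒Cone d {p} (γ , γ≥0 , p≈) = Cone-resp (λ k → sym (p≈ k)) (partial (suc ⌊ d /2⌋) ℕₚ.≤-refl)
      where
      -- Up to ⌊d/2⌋ the exponent d - 2 i is not truncated, as the degree equation in `mono`
      -- demands.
      double≤ : ∀ {i} → i ℕ.≤ ⌊ d /2⌋ → i +ℕ i ℕ.≤ d
      double≤ i≤ = ℕₚ.≤-trans (ℕₚ.+-mono-≤ i≤ (ℕₚ.≤-trans i≤ (ℕₚ.⌊n/2⌋≤⌈n/2⌉ d))) (ℕₚ.≤-reflexive (ℕₚ.⌊n/2⌋+⌈n/2⌉≡n d))
      partial : ∀ n → n ℕ.≤ suc ⌊ d /2⌋ → Cone d (λ k → sumTo F n (λ i → γ i * fromℕ F (coef i (d ℕ.∸ (i +ℕ i)) k)))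
      partial zero    _        = nil (λ _ → refl)
      partial (suc n) (s≤s n≤) = add (partial n (ℕₚ.m≤n⇒m≤1+n n≤))
        (mono {κ = constant (γ n)} n (d ℕ.∸ (n +ℕ n)) (γ n , γ≥0 n , λ _ → refl) (ℕₚ.m+[n∸m]≡n (double≤ n≤))
          (λ k → sym (trans (mul-constant (γ n) (mul F (X ^ n) (J.v ^ (d ℕ.∸ (n +ℕ n)))) k) (*-congˡ (X^v^-coefficient n (d ℕ.∸ (n +ℕ n)) k)))))
        (λ _ → refl)

    dirac : ℕ → Carrier → ℕ → Carrier
    dirac zero    a j       = constant a j
    dirac (suc i) a zero    = 0#
    dirac (suc i) a (suc j) = dirac i a j

    dirac-nonneg : ∀ i {a} → 0# ≤ a → ∀ j → 0# ≤ dirac i a j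
    dirac-nonneg zero    0≤a zero    = 0≤a
    dirac-nonneg zero    0≤a (suc j) = ≤-refl
    dirac-nonneg (suc i) 0≤a zero    = ≤-refl
    dirac-nonneg (suc i) 0≤a (suc j) = dirac-nonneg i 0≤a j

    sumTo-dirac : ∀ n i a (f : ℕ → Carrier) → i ℕ.< n → sumTo F n (λ j → dirac i a j * f j) ≈ a * f i
    sumTo-dirac (suc n) zero    a f _         = trans (sumTo-head n _)
      (trans (+-congˡ (sumTo-0 n (λ j → zeroˡ _))) (+-identityʳ _))
    sumTo-dirac (suc n) (suc i) a f (s≤s i<n) = trans (sumTo-head n _)
      (trans (+-cong (zeroˡ _) (sumTo-dirac n i a (f ∘ suc) i<n)) (+-identityˡ _))

    -- A generator is one term of a γ-expansion, with its whole weight at i; a sum of forms adds the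
    -- γ-vectors.
    Cone⇒GammaPos : ∀ d {p} → Cone d p → GammaPos F d p
    Cone⇒GammaPos d (nil p≈0) = (λ _ → 0#) , (λ _ → ≤-refl) ,
      λ k → trans (p≈0 k) (sym (sumTo-0 (suc ⌊ d /2⌋) (λ i → zeroˡ _)))
    Cone⇒GammaPos d {p} (mono i m κ∈@(a , 0≤a , _) eq p≈) = dirac i a , dirac-nonneg i 0≤a , λ k → begin
      p k                                              ≈⟨ trans (p≈ k) (S-mul κ∈ (mul F (X ^ i) (J.v ^ m)) k) ⟩
      a * mul F (X ^ i) (J.v ^ m) k                    ≈⟨ *-congˡ (X^v^-coefficient i m k) ⟩
      a * fromℕ F (coef i m k)                         ≈⟨ reflexive (≡.cong (λ n → a * fromℕ F (coef i n k)) m≡) ⟩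
      a * fromℕ F (coef i (d ℕ.∸ (i +ℕ i)) k)
        ≈⟨ sumTo-dirac (suc ⌊ d /2⌋) i a (λ j → fromℕ F (coef j (d ℕ.∸ (j +ℕ j)) k)) (s≤s i≤) ⟨
      gammaExp F (suc ⌊ d /2⌋) d (dirac i a) k         ∎
      where
      m≡ : m ≡ d ℕ.∸ (i +ℕ i)
      m≡ = ≡.trans (≡.sym (ℕₚ.m+n∸m≡n (i +ℕ i) m)) (≡.cong (ℕ._∸ (i +ℕ i)) eq)
      i≤ : i ℕ.≤ ⌊ d /2⌋
      i≤ = ≡.subst (ℕ._≤ ⌊ d /2⌋) (≡.sym (ℕₚ.n≡⌊n+n/2⌋ i))
        (ℕₚ.⌊n/2⌋-mono (≡.subst (i +ℕ i ℕ.≤_) eq (ℕₚ.m≤m+n (i +ℕ i) m)))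
    Cone⇒GammaPos d {p} (add {g} {h} u w p≈) with Cone⇒GammaPos d u | Cone⇒GammaPos d w
    ... | γ , γ≥0 , g≈ | δ , δ≥0 , h≈ = (λ i → γ i + δ i) , (λ i → +-nonneg (γ≥0 i) (δ≥0 i)) , λ k → begin
      p k         ≈⟨ p≈ k ⟩
      g k + h k   ≈⟨ +-cong (g≈ k) (h≈ k) ⟩
      gammaExp F (suc ⌊ d /2⌋) d γ k + gammaExp F (suc ⌊ d /2⌋) d δ k    ≈⟨ sumTo-+ (suc ⌊ d /2⌋) _ _ ⟨
      sumTo F (suc ⌊ d /2⌋) (λ i → γ i * fromℕ F (coef i (d ℕ.∸ (i +ℕ i)) k) + δ i * fromℕ F (coef i (d ℕ.∸ (i +ℕ i)) k))
        ≈⟨ sumTo-cong (suc ⌊ d /2⌋) (λ i → distribʳ _ _ _) ⟨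
      gammaExp F (suc ⌊ d /2⌋) d (λ i → γ i + δ i) k                     ∎

    GammaPosSymDecomp⇒Decomposition : ∀ d {h} → GammaPosSymDecomp F d h → Decomposition d h
    GammaPosSymDecomp⇒Decomposition d (a , b′ , (h≈ , A , B) , a-pos , b-pos) =
      a , b′ , GammaPos⇒Cone d a-pos , pred d B b-pos , λ k → trans (h≈ k) (+-congˡ (sym (X-mul b′ k)))
      where
      pred : ∀ d {p} → Palin-pred F d p → GammaPos-pred F d p → Kp d p
      pred zero    p≈0 _   = Level.lift p≈0
      -- `⌊ suc (suc d) /2⌋` reduces to `suc ⌊ d /2⌋`, so both kinds of γ-expansion coincide here.
      pred (suc d) _   pos = GammaPos⇒Cone d pos

    Decomposition⇒GammaPosSymDecomp : ∀ d {h} → Decomposition d h → GammaPosSymDecomp F d h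
    Decomposition⇒GammaPosSymDecomp d (f , g , f∈ , g∈ , h≈) = f , g ,
      ((λ k → trans (h≈ k) (+-congˡ (X-mul g k))) , Symmetric⇒Palin (Cone⇒Symmetric (J.v ^_) Symmetric-v^ f∈) , Kp⇒Palin-pred (J.v ^_) Symmetric-v^ d g∈) ,
      Cone⇒GammaPos d f∈ , pred d g∈
      where
      pred : ∀ d {p} → Kp d p → GammaPos-pred F d p
      pred zero    (Level.lift p≈0) = (λ _ → 0#) , (λ _ → ≤-refl) , p≈0
      pred (suc d) u = Cone⇒GammaPos d u

open import Data.Nat using (_+_)

theorem1p4 : ∀ {c ℓ₁ ℓ₂} (F : OrderedField c ℓ₁ ℓ₂) (d e : ℕ) (p q : Poly F)
    → HasDegree F d p → HasDegree F e q
    → ((NonnegSymDecomp F d (W F d p) → NonnegSymDecomp F e (W F e q)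
    → NonnegSymDecomp F (d + e) (W F (d + e) (mul F p q)))
    × (GammaPosSymDecomp F d (W F d p) → GammaPosSymDecomp F e (W F e q)
    → GammaPosSymDecomp F (d + e) (W F (d + e) (mul F p q))))
theorem1p4 F d e p q p-deg q-deg =
    (λ P Q → Decomposition⇒NonnegSymDecomp (d + e) (product Binomial.Decomposition-resp Binomial.Decomposition-*
      (NonnegSymDecomp⇒Decomposition d P) (NonnegSymDecomp⇒Decomposition e Q)))
  , (λ P Q → Decomposition⇒GammaPosSymDecomp (d + e) (product Gamma.Decomposition-resp Gamma.Decomposition-*
      (GammaPosSymDecomp⇒Decomposition d P) (GammaPosSymDecomp⇒Decomposition e Q)))
  where
  open Series F
  open Coefficients F
  open Binomial using (NonnegSymDecomp⇒Decomposition; Decomposition⇒NonnegSymDecomp)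
  open Gamma using (GammaPosSymDecomp⇒Decomposition; Decomposition⇒GammaPosSymDecomp)
  -- `D` becomes the `Decomposition` of either cone, so that the passage between `W` and `J.𝒲` is
  -- made once.
  product : ∀ {ℓ} {D : ℕ → Poly F → Set ℓ} →
    (∀ {n f g} → f 𝓡.≈ g → D n f → D n g) →
    (∀ {d e P M Q} → J.Multiplier d P M → D d (J.𝒲 d P) → D e (J.𝒲 e Q) → D (d + e) (J.𝒲 (d + e) (M Q))) →
    D d (W F d p) → D e (W F e q) → D (d + e) (W F (d + e) (mul F p q))
  product resp mult P Q = resp (𝓡.sym (W-mul p-deg q-deg))
    (mult {Q = evalAt F e q} (multiplier d p) (resp (W≈ d p) P) (resp (W≈ e q) Q))
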